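{- For every real number $a$, every positive integer $m$, every integer $n\ge 0$ and every real number $x$, $$\widetilde{F}_{m,a}(n;x)=\int_{0}^{\infty}\widetilde{D}_{m,a}(n;x\lambda)\,e^{ -\lambda}\,d\lambda.$$
   Context: For a real number $a$, a positive integer $m$ and integers $n,k\ge 0$, the noncentral Whitney numbers of the second kind are given by $$\widetilde{W}_{m,a}(n,k)=\frac{1}{m^k k!}\sum_{j=0}^{k}\binom{k}{j}(-1)^{k-j}(mj-a)^n,$$ with the convention $0^0=1$. The noncentral Tanny-Dowling polynomials are $$\widetilde{F}_{m,a}(n;x)=\sum_{k=0}^{n}k!\,\widetilde{W}_{m,a}(n,k)\,x^k,$$ and the noncentral Dowling polynomials are $$\widetilde{D}_{m,a}(n;x)=\sum_{k=0}^{n}\widetilde{W}_{m,a}(n,k)\,x^k.$$ -}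

module Defs where

open import Algebra.Bundles using (RawRing)
open import Data.Fin.Base as Fin using (Fin; toℕ; inject₁; fromℕ)
open import Data.Integer.Base as ℤ using (+_)
open import Data.Nat.Base as ℕ using (ℕ; zero; suc; _!; _∸_; NonZero)
open import Data.Nat.Combinatorics using (_C_)
open import Data.Nat.Properties as ℕₚ using (_!≢0)
open import Data.Product.Base using (Σ-syntax; ∃-syntax; _×_; _,_)
open import Data.Rational.Base as ℚ using (ℚ; 0ℚ; 1ℚ; ½)
open import Data.Sum.Base using (inj₁; inj₂)
import Data.Fin.Properties as Finₚ
import Data.Integer.Properties as ℤₚ
import Data.Rational.Properties as ℚₚ
import Data.Rational.Solver as ℚ-Solver
import Data.Rational.Unnormalised.Base as ℚᵘ
import Data.Rational.Unnormalised.Properties as ℚᵘₚ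
import Algebra.Definitions.RawSemiring as RawSemiringDefs
import Algebra.Properties.Monoid.Sum as MonoidSum
open import Level using (0ℓ)
open import Relation.Binary.PropositionalEquality
  using (_≡_; refl; sym; trans; cong; cong₂; subst; subst₂)

-- Real numbers as Cauchy sequences of rationals, up to _≈_ below.

Cauchy : (ℕ → ℚ) → Set
Cauchy s = ∀ ε → 0ℚ ℚ.< ε →
  ∃[ N ] (∀ m n → N ℕ.≤ m → N ℕ.≤ n → ℚ.∣ s m ℚ.- s n ∣ ℚ.≤ ε)

recip : (n : ℕ) .{{_ : NonZero n}} → ℚ
recip n = + 1 ℚ./ n

module ℚSemiring = RawSemiringDefs ℚ.+-*-rawSemiring

expTerm : ℚ → ℕ → ℚ
expTerm q j = (q ℚSemiring.^ j) ℚ.* recip (j !) {{j !≢0}}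

expPartial : ℕ → ℚ → ℚ
expPartial n q = ℚSemiring.sum {suc n} (λ j → expTerm q (toℕ j))

module CauchyProperties where

  open import Data.Rational.Base using (_+_; _*_; _-_; -_; ∣_∣; _≤_; _<_)
  open ℚₚ.≤-Reasoning
  open ℚ-Solver.+-*-Solver using (solve; _:+_; _:*_; _:-_; :-_; _:=_; con)

  *-mono : ∀ {p q r s} → 0ℚ ≤ r → 0ℚ ≤ q → p ≤ q → r ≤ s → p * r ≤ q * s
  *-mono {p} {q} {r} {s} 0≤r 0≤q p≤q r≤s = ℚₚ.≤-trans
    (ℚₚ.*-monoʳ-≤-nonNeg r {{ℚ.nonNegative 0≤r}} p≤q)
    (ℚₚ.*-monoˡ-≤-nonNeg q {{ℚ.nonNegative 0≤q}} r≤s)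

  0≤* : ∀ {p q} → 0ℚ ≤ p → 0ℚ ≤ q → 0ℚ ≤ p * q
  0≤* {p} {q} 0≤p 0≤q = ℚₚ.nonNegative⁻¹ (p * q)
    {{ℚₚ.nonNeg*nonNeg⇒nonNeg p {{ℚ.nonNegative 0≤p}} q {{ℚ.nonNegative 0≤q}}}}

  0<* : ∀ {p q} → 0ℚ < p → 0ℚ < q → 0ℚ < p * q
  0<* {p} {q} 0<p 0<q = ℚₚ.positive⁻¹ (p * q)
    {{ℚₚ.pos*pos⇒pos p {{ℚ.positive 0<p}} q {{ℚ.positive 0<q}}}}

  0≤+ : ∀ {p q} → 0ℚ ≤ p → 0ℚ ≤ q → 0ℚ ≤ p + q
  0≤+ 0≤p 0≤q = ℚₚ.+-mono-≤ 0≤p 0≤q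

  inverse : ∀ {p} → 0ℚ < p → ∃[ q ] (0ℚ < q × p * q ≡ 1ℚ)
  inverse {p} 0<p =
    (ℚ.1/ p) , ℚₚ.positive⁻¹ (ℚ.1/ p) {{ℚₚ.1/pos⇒pos p}} , ℚₚ.*-inverseʳ p
    where instance
      pos : ℚ.Positive p
      pos = ℚ.positive 0<p
      nz : ℚ.NonZero p
      nz = ℚₚ.pos⇒nonZero p

  ∣∣-sub-comm : ∀ p q → ∣ p - q ∣ ≡ ∣ q - p ∣
  ∣∣-sub-comm p q = trans (sym (ℚₚ.∣-p∣≡∣p∣ (p - q)))
    (cong ∣_∣ (solve 2 (λ p q → :- (p :- q) := q :- p) refl p q))

  ∣∣-triangle : ∀ p q r → ∣ p - r ∣ ≤ ∣ p - q ∣ + ∣ q - r ∣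
  ∣∣-triangle p q r = subst (λ t → ∣ t ∣ ≤ ∣ p - q ∣ + ∣ q - r ∣)
    (solve 3 (λ p q r → (p :- q) :+ (q :- r) := p :- r) refl p q r)
    (ℚₚ.∣p+q∣≤∣p∣+∣q∣ (p - q) (q - r))

  p≤∣p∣ : ∀ p → p ≤ ∣ p ∣
  p≤∣p∣ p with ℚₚ.≤-total 0ℚ p
  ... | inj₁ 0≤p = ℚₚ.≤-reflexive (sym (ℚₚ.0≤p⇒∣p∣≡p 0≤p))
  ... | inj₂ p≤0 = ℚₚ.≤-trans p≤0 (ℚₚ.0≤∣p∣ p)

  ∣∣≤ : ∀ {p q} → p ≤ q → - p ≤ q → ∣ p ∣ ≤ q
  ∣∣≤ {p} p≤q -p≤q with ℚₚ.∣p∣≡p∨∣p∣≡-p p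
  ... | inj₁ eq = subst (_≤ _) (sym eq) p≤q
  ... | inj₂ eq = subst (_≤ _) (sym eq) -p≤q

  sub-≤ : ∀ {p q r} → p ≤ q + r → p - r ≤ q
  sub-≤ {p} {q} {r} h = subst (p - r ≤_)
    (solve 2 (λ q r → (q :+ r) :- r := q) refl q r)
    (ℚₚ.+-monoˡ-≤ (- r) h)

  ∣∣-sub-bound : ∀ p q → ∣ p ∣ - ∣ q ∣ ≤ ∣ p - q ∣
  ∣∣-sub-bound p q = sub-≤ (subst (λ t → ∣ t ∣ ≤ ∣ p - q ∣ + ∣ q ∣)
    (solve 2 (λ p q → (p :- q) :+ q := p) refl p q)
    (ℚₚ.∣p+q∣≤∣p∣+∣q∣ (p - q) q))

  reverse-triangle : ∀ p q → ∣ ∣ p ∣ - ∣ q ∣ ∣ ≤ ∣ p - q ∣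
  reverse-triangle p q = ∣∣≤ (∣∣-sub-bound p q)
    (subst₂ _≤_
      (solve 2 (λ p q → q :- p := :- (p :- q)) refl ∣ p ∣ ∣ q ∣)
      (∣∣-sub-comm q p)
      (∣∣-sub-bound q p))

  rescale : ∀ s A → 0ℚ < A →
    (∀ ε → 0ℚ < ε → ∃[ N ] (∀ m n → N ℕ.≤ m → N ℕ.≤ n → ∣ s m - s n ∣ ≤ A * ε)) →
    Cauchy s
  rescale s A 0<A h ε 0<ε =
    let D , 0<D , AD≡1 = inverse 0<A
        N , near       = h (D * ε) (0<* 0<D 0<ε)
    in N , λ m n N≤m N≤n → ℚₚ.≤-trans (near m n N≤m N≤n)
      (ℚₚ.≤-reflexive (trans (sym (ℚₚ.*-assoc A D ε))
        (trans (cong (_* ε) AD≡1) (ℚₚ.*-identityˡ ε))))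

  bounded : ∀ s → Cauchy s →
    ∃[ K ] (0ℚ < K × ∃[ N ] (∀ n → N ℕ.≤ n → ∣ s n ∣ ≤ K))
  bounded s c =
    let N , near = c 1ℚ (ℚₚ.positive⁻¹ 1ℚ)
    in (1ℚ + ∣ s N ∣)
     , ℚₚ.+-mono-<-≤ (ℚₚ.positive⁻¹ 1ℚ) (ℚₚ.0≤∣p∣ (s N))
     , N , λ n N≤n → begin
         ∣ s n ∣
           ≡⟨ cong ∣_∣ (solve 2 (λ p q → p := (p :- q) :+ q) refl (s n) (s N)) ⟩
         ∣ (s n - s N) + s N ∣     ≤⟨ ℚₚ.∣p+q∣≤∣p∣+∣q∣ (s n - s N) (s N) ⟩
         ∣ s n - s N ∣ + ∣ s N ∣   ≤⟨ ℚₚ.+-monoˡ-≤ ∣ s N ∣ (near n N N≤n ℕₚ.≤-refl) ⟩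
         1ℚ + ∣ s N ∣              ∎

  ⊔₁ : ∀ {a b n} → a ℕ.⊔ b ℕ.≤ n → a ℕ.≤ n
  ⊔₁ {a} {b} = ℕₚ.m⊔n≤o⇒m≤o a b

  ⊔₂ : ∀ {a b n} → a ℕ.⊔ b ℕ.≤ n → b ℕ.≤ n
  ⊔₂ {a} {b} = ℕₚ.m⊔n≤o⇒n≤o a b

  const-cauchy : ∀ q → Cauchy (λ _ → q)
  const-cauchy q ε 0<ε = 0 , λ _ _ _ _ →
    subst (λ t → ∣ t ∣ ≤ ε) (sym (ℚₚ.+-inverseʳ q)) (ℚₚ.<⇒≤ 0<ε)

  neg-cauchy : ∀ s → Cauchy s → Cauchy (λ n → - s n)
  neg-cauchy s c ε 0<ε =
    let N , near = c ε 0<ε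
    in N , λ m n N≤m N≤n → subst (λ t → ∣ t ∣ ≤ ε)
      (solve 2 (λ p q → q :- p := (:- p) :- (:- q)) refl (s m) (s n))
      (near n m N≤n N≤m)

  abs-cauchy : ∀ s → Cauchy s → Cauchy (λ n → ∣ s n ∣)
  abs-cauchy s c ε 0<ε =
    let N , near = c ε 0<ε
    in N , λ m n N≤m N≤n →
      ℚₚ.≤-trans (reverse-triangle (s m) (s n)) (near m n N≤m N≤n)

  +-cauchy : ∀ s t → Cauchy s → Cauchy t → Cauchy (λ n → s n + t n)
  +-cauchy s t c d = rescale (λ n → s n + t n) (1ℚ + 1ℚ) (ℚₚ.positive⁻¹ (1ℚ + 1ℚ)) λ ε 0<ε →
    let M , near₁ = c ε 0<ε
        N , near₂ = d ε 0<ε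
    in M ℕ.⊔ N , λ m n ≤m ≤n → begin
      ∣ (s m + t m) - (s n + t n) ∣
        ≡⟨ cong ∣_∣ (solve 4 (λ a b c d → (a :+ b) :- (c :+ d) := (a :- c) :+ (b :- d))
             refl (s m) (t m) (s n) (t n)) ⟩
      ∣ (s m - s n) + (t m - t n) ∣
        ≤⟨ ℚₚ.∣p+q∣≤∣p∣+∣q∣ (s m - s n) (t m - t n) ⟩
      ∣ s m - s n ∣ + ∣ t m - t n ∣
        ≤⟨ ℚₚ.+-mono-≤ (near₁ m n (⊔₁ {M} {N} ≤m) (⊔₁ {M} {N} ≤n))
                       (near₂ m n (⊔₂ {M} {N} ≤m) (⊔₂ {M} {N} ≤n)) ⟩
      ε + ε
        ≡⟨ solve 1 (λ e → e :+ e := (con 1ℚ :+ con 1ℚ) :* e) refl ε ⟩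
      (1ℚ + 1ℚ) * ε ∎

  ∣*-*∣≤ : ∀ p q p′ q′ → ∣ p * q - p′ * q′ ∣ ≤ ∣ p ∣ * ∣ q - q′ ∣ + ∣ q′ ∣ * ∣ p - p′ ∣
  ∣*-*∣≤ p q p′ q′ = begin
    ∣ p * q - p′ * q′ ∣
      ≡⟨ cong ∣_∣ (solve 4 (λ p q p′ q′ →
           p :* q :- p′ :* q′ := p :* (q :- q′) :+ q′ :* (p :- p′)) refl p q p′ q′) ⟩
    ∣ p * (q - q′) + q′ * (p - p′) ∣
      ≤⟨ ℚₚ.∣p+q∣≤∣p∣+∣q∣ (p * (q - q′)) (q′ * (p - p′)) ⟩
    ∣ p * (q - q′) ∣ + ∣ q′ * (p - p′) ∣
      ≡⟨ cong₂ _+_ (ℚₚ.∣p*q∣≡∣p∣*∣q∣ p (q - q′)) (ℚₚ.∣p*q∣≡∣p∣*∣q∣ q′ (p - p′)) ⟩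
    ∣ p ∣ * ∣ q - q′ ∣ + ∣ q′ ∣ * ∣ p - p′ ∣ ∎

  *-cauchy : ∀ s t → Cauchy s → Cauchy t → Cauchy (λ n → s n * t n)
  *-cauchy s t c d =
    let K , 0<K , P , s≤K = bounded s c
        L , 0<L , Q , t≤L = bounded t d
    in rescale (λ n → s n * t n) (K + L) (ℚₚ.+-mono-< 0<K 0<L) λ ε 0<ε →
      let M , near₁ = c ε 0<ε
          N , near₂ = d ε 0<ε
      in (P ℕ.⊔ Q) ℕ.⊔ (M ℕ.⊔ N) , λ m n ≤m ≤n →
        let P≤m = ⊔₁ {P} {Q} (⊔₁ {P ℕ.⊔ Q} {M ℕ.⊔ N} ≤m)
            Q≤n = ⊔₂ {P} {Q} (⊔₁ {P ℕ.⊔ Q} {M ℕ.⊔ N} ≤n)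
            MN≤m = ⊔₂ {P ℕ.⊔ Q} {M ℕ.⊔ N} ≤m
            MN≤n = ⊔₂ {P ℕ.⊔ Q} {M ℕ.⊔ N} ≤n
        in begin
          ∣ s m * t m - s n * t n ∣
            ≤⟨ ∣*-*∣≤ (s m) (t m) (s n) (t n) ⟩
          ∣ s m ∣ * ∣ t m - t n ∣ + ∣ t n ∣ * ∣ s m - s n ∣
            ≤⟨ ℚₚ.+-mono-≤
                 (*-mono (ℚₚ.0≤∣p∣ (t m - t n)) (ℚₚ.<⇒≤ 0<K) (s≤K m P≤m)
                   (near₂ m n (⊔₂ {M} {N} MN≤m) (⊔₂ {M} {N} MN≤n)))
                 (*-mono (ℚₚ.0≤∣p∣ (s m - s n)) (ℚₚ.<⇒≤ 0<L) (t≤L n Q≤n)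
                   (near₁ m n (⊔₁ {M} {N} MN≤m) (⊔₁ {M} {N} MN≤n))) ⟩
          K * ε + L * ε
            ≡⟨ sym (ℚₚ.*-distribʳ-+ ε K L) ⟩
          (K + L) * ε ∎

  toℚᵘ-/ : ∀ i n → ℚ.toℚᵘ (i ℚ./ suc n) ℚᵘ.≃ ℚᵘ.mkℚᵘ i n
  toℚᵘ-/ i n = ℚₚ.toℚᵘ-fromℚᵘ (ℚᵘ.mkℚᵘ i n)

  recip-* : ∀ m n .{{_ : NonZero m}} .{{_ : NonZero n}} .{{_ : NonZero (m ℕ.* n)}} →
    recip (m ℕ.* n) ≡ recip m * recip n
  recip-* (suc m) (suc n) = ℚₚ.toℚᵘ-injective (ℚᵘₚ.≃-trans
    (toℚᵘ-/ (+ 1) (n ℕ.+ m ℕ.* suc n))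
    (ℚᵘₚ.≃-sym (ℚᵘₚ.≃-trans
      (ℚₚ.toℚᵘ-homo-* (recip (suc m)) (recip (suc n)))
      (ℚᵘₚ.*-cong (toℚᵘ-/ (+ 1) m) (toℚᵘ-/ (+ 1) n)))))

  recip-inverse : ∀ n .{{_ : NonZero n}} → recip n * (+ n ℚ./ 1) ≡ 1ℚ
  recip-inverse (suc n) = ℚₚ.toℚᵘ-injective (ℚᵘₚ.≃-trans
    (ℚₚ.toℚᵘ-homo-* (recip (suc n)) (+ suc n ℚ./ 1))
    (ℚᵘₚ.≃-trans (ℚᵘₚ.*-cong (toℚᵘ-/ (+ 1) n) (toℚᵘ-/ (+ suc n) 0))
      (ℚᵘ.*≡* (cong +_ (trans (ℕₚ.*-identityʳ (1 ℕ.* suc n))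
        (sym (trans (ℕₚ.*-identityˡ (suc n ℕ.* 1)) (ℕₚ.*-comm (suc n) 1))))))))

  0<recip : ∀ n .{{_ : NonZero n}} → 0ℚ < recip n
  0<recip n = ℚₚ.positive⁻¹ (recip n) {{ℚₚ.normalize-pos 1 n}}

  fromℕ-suc : ∀ n → + suc n ℚ./ 1 ≡ 1ℚ + (+ n ℚ./ 1)
  fromℕ-suc n = ℚₚ.toℚᵘ-injective (ℚᵘₚ.≃-trans (toℚᵘ-/ (+ suc n) 0)
    (ℚᵘₚ.≃-sym (ℚᵘₚ.≃-trans (ℚₚ.toℚᵘ-homo-+ 1ℚ (+ n ℚ./ 1))
      (ℚᵘₚ.≃-trans (ℚᵘₚ.+-congʳ (ℚ.toℚᵘ 1ℚ) (toℚᵘ-/ (+ n) 0))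
        (ℚᵘ.*≡* (cong (λ t → (+ 1 ℤ.+ t) ℤ.* + 1) (ℤₚ.*-identityʳ (+ n))))))))

  archimedean : ∀ ε → 0ℚ < ε → ∃[ N ] (∀ n → N ℕ.≤ n → recip (suc n) ≤ ε)
  archimedean ε 0<ε = go ε {{ℚ.positive 0<ε}}
    where
    go : ∀ ε {{_ : ℚ.Positive ε}} → ∃[ N ] (∀ n → N ℕ.≤ n → recip (suc n) ≤ ε)
    go (ℚ.mkℚ (+ suc p) d _) = d , λ n d≤n → ℚₚ.toℚᵘ-cancel-≤
      (ℚᵘₚ.≤-respˡ-≃ (ℚᵘₚ.≃-sym (toℚᵘ-/ (+ 1) n))
        (ℚᵘ.*≤* (ℤ.+≤+ (ℕₚ.*-mono-≤ {1} {suc p} (ℕ.s≤s ℕ.z≤n) (ℕ.s≤s d≤n)))))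

  expTerm-suc : ∀ q j → expTerm q (suc j) ≡ expTerm q j * (q * recip (suc j))
  expTerm-suc q j = trans
    (cong ((q * (q ℚSemiring.^ j)) *_)
      (recip-* (suc j) (j !) {{_}} {{j !≢0}} {{suc j !≢0}}))
    (solve 4 (λ q p a b → (q :* p) :* (a :* b) := (p :* b) :* (q :* a)) refl
      q (q ℚSemiring.^ j) (recip (suc j)) (recip (j !) {{j !≢0}}))

  expPartial-suc : ∀ n q → expPartial (suc n) q ≡ expPartial n q + expTerm q (suc n)
  expPartial-suc n q = trans
    (sum-init-last {suc n} (λ j → expTerm q (toℕ j)))
    (cong₂ _+_
      (sum-cong-≗ {suc n} (λ i → cong (expTerm q) (Finₚ.toℕ-inject₁ i)))
      (cong (expTerm q) (Finₚ.toℕ-fromℕ (suc n))))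
    where open MonoidSum ℚₚ.+-0-monoid

  module _ {K : ℚ} (0<K : 0ℚ < K) where

    0≤K : 0ℚ ≤ K
    0≤K = ℚₚ.<⇒≤ 0<K

    0≤factor : ∀ j → 0ℚ ≤ K * recip (suc j)
    0≤factor j = 0≤* 0≤K (ℚₚ.<⇒≤ (0<recip (suc j)))

    0≤expTerm : ∀ j → 0ℚ ≤ expTerm K j
    0≤expTerm zero = ℚₚ.<⇒≤ (ℚₚ.positive⁻¹ 1ℚ)
    0≤expTerm (suc j) = subst (0ℚ ≤_) (sym (expTerm-suc K j))
      (0≤* (0≤expTerm j) (0≤factor j))

    ∣factor∣≤ : ∀ {q} j → ∣ q ∣ ≤ K → ∣ q * recip (suc j) ∣ ≤ K * recip (suc j)
    ∣factor∣≤ {q} j q≤K = begin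
      ∣ q * recip (suc j) ∣       ≡⟨ ℚₚ.∣p*q∣≡∣p∣*∣q∣ q (recip (suc j)) ⟩
      ∣ q ∣ * ∣ recip (suc j) ∣   ≡⟨ cong (∣ q ∣ *_) (ℚₚ.0≤p⇒∣p∣≡p 0≤r) ⟩
      ∣ q ∣ * recip (suc j)       ≤⟨ *-mono 0≤r 0≤K q≤K ℚₚ.≤-refl ⟩
      K * recip (suc j)           ∎
      where
      0≤r : 0ℚ ≤ recip (suc j)
      0≤r = ℚₚ.<⇒≤ (0<recip (suc j))

    ∣expTerm∣≤ : ∀ {q} j → ∣ q ∣ ≤ K → ∣ expTerm q j ∣ ≤ expTerm K j
    ∣expTerm∣≤ zero _ = ℚₚ.≤-refl
    ∣expTerm∣≤ {q} (suc j) q≤K = begin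
      ∣ expTerm q (suc j) ∣                        ≡⟨ cong ∣_∣ (expTerm-suc q j) ⟩
      ∣ expTerm q j * (q * recip (suc j)) ∣        ≡⟨ ℚₚ.∣p*q∣≡∣p∣*∣q∣ (expTerm q j) _ ⟩
      ∣ expTerm q j ∣ * ∣ q * recip (suc j) ∣
        ≤⟨ *-mono (ℚₚ.0≤∣p∣ (q * recip (suc j))) (0≤expTerm j)
             (∣expTerm∣≤ j q≤K) (∣factor∣≤ j q≤K) ⟩
      expTerm K j * (K * recip (suc j))            ≡⟨ sym (expTerm-suc K j) ⟩
      expTerm K (suc j)                            ∎

    expPartial-mono : ∀ n → expPartial n K ≤ expPartial (suc n) K
    expPartial-mono n = begin
      expPartial n K                       ≡⟨ sym (ℚₚ.+-identityʳ _) ⟩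
      expPartial n K + 0ℚ                  ≤⟨ ℚₚ.+-monoʳ-≤ (expPartial n K) (0≤expTerm (suc n)) ⟩
      expPartial n K + expTerm K (suc n)   ≡⟨ sym (expPartial-suc n K) ⟩
      expPartial (suc n) K                 ∎

    0≤expPartial : ∀ n → 0ℚ ≤ expPartial n K
    0≤expPartial zero = ℚₚ.<⇒≤ (ℚₚ.positive⁻¹ 1ℚ)
    0≤expPartial (suc n) = ℚₚ.≤-trans (0≤expPartial n) (expPartial-mono n)

    expTerm-lipschitz : ∀ {q r} → ∣ q ∣ ≤ K → ∣ r ∣ ≤ K → ∀ j →
      ∣ expTerm q (suc j) - expTerm r (suc j) ∣ ≤ ∣ q - r ∣ * expTerm K j
    expTerm-lipschitz {q} {r} q≤K r≤K zero = ℚₚ.≤-reflexive (trans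
      (cong ∣_∣ (solve 2 (λ q r → (q :* con 1ℚ) :* con 1ℚ :- (r :* con 1ℚ) :* con 1ℚ := q :- r) refl q r))
      (sym (ℚₚ.*-identityʳ ∣ q - r ∣)))
    expTerm-lipschitz {q} {r} q≤K r≤K (suc j) = begin
      ∣ expTerm q (2 ℕ.+ j) - expTerm r (2 ℕ.+ j) ∣
        ≡⟨ cong₂ (λ u v → ∣ u - v ∣) (expTerm-suc q (suc j)) (expTerm-suc r (suc j)) ⟩
      ∣ a * (q * c) - b * (r * c) ∣
        ≡⟨ cong₂ (λ u v → ∣ u - v ∣) (ℚₚ.*-comm a (q * c)) (ℚₚ.*-comm b (r * c)) ⟩
      ∣ (q * c) * a - (r * c) * b ∣
        ≤⟨ ∣*-*∣≤ (q * c) a (r * c) b ⟩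
      ∣ q * c ∣ * ∣ a - b ∣ + ∣ b ∣ * ∣ q * c - r * c ∣
        ≡⟨ cong (λ t → ∣ q * c ∣ * ∣ a - b ∣ + ∣ b ∣ * t) qc-rc ⟩
      ∣ q * c ∣ * ∣ a - b ∣ + ∣ b ∣ * (∣ q - r ∣ * c)
        ≤⟨ ℚₚ.+-mono-≤
             (*-mono (ℚₚ.0≤∣p∣ (a - b)) (0≤factor (suc j)) (∣factor∣≤ (suc j) q≤K)
               (expTerm-lipschitz q≤K r≤K j))
             (*-mono (0≤* (ℚₚ.0≤∣p∣ (q - r)) 0≤c) (0≤expTerm (suc j))
               (∣expTerm∣≤ (suc j) r≤K) ℚₚ.≤-refl) ⟩
      (K * c) * (D * e) + e′ * (D * c)
        ≡⟨ cong (_+ e′ * (D * c)) (cong (λ t → (K * c) * (D * t)) (sym (ℚₚ.*-identityʳ e))) ⟩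
      (K * c) * (D * (e * 1ℚ)) + e′ * (D * c)
        ≡⟨ cong (λ t → (K * c) * (D * (e * t)) + e′ * (D * c)) (sym (recip-inverse (suc j))) ⟩
      (K * c) * (D * (e * (recip (suc j) * n))) + e′ * (D * c)
        ≡⟨ solve 7 (λ K c D e i n e′ →
             (K :* c) :* (D :* (e :* (i :* n))) :+ e′ :* (D :* c)
             := D :* c :* (e :* (K :* i) :* n :+ e′))
             refl K c D e (recip (suc j)) n e′ ⟩
      D * c * (e * (K * recip (suc j)) * n + e′)
        ≡⟨ cong (λ t → D * c * (t * n + e′)) (sym (expTerm-suc K j)) ⟩
      D * c * (e′ * n + e′)
        ≡⟨ solve 4 (λ D c n e′ → D :* c :* (e′ :* n :+ e′) := D :* e′ :* (c :* (con 1ℚ :+ n)))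
             refl D c n e′ ⟩
      D * e′ * (c * (1ℚ + n))
        ≡⟨ cong (λ t → D * e′ * (c * t)) (sym (fromℕ-suc (suc j))) ⟩
      D * e′ * (c * (+ (2 ℕ.+ j) ℚ./ 1))
        ≡⟨ cong (D * e′ *_) (recip-inverse (2 ℕ.+ j)) ⟩
      D * e′ * 1ℚ
        ≡⟨ ℚₚ.*-identityʳ (D * e′) ⟩
      D * e′ ∎
      where
      a b c D e e′ n : ℚ
      a  = expTerm q (suc j)
      b  = expTerm r (suc j)
      c  = recip (2 ℕ.+ j)
      D  = ∣ q - r ∣
      e  = expTerm K j
      e′ = expTerm K (suc j)
      n  = + suc j ℚ./ 1
      0≤c : 0ℚ ≤ c
      0≤c = ℚₚ.<⇒≤ (0<recip (2 ℕ.+ j))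
      qc-rc : ∣ q * c - r * c ∣ ≡ D * c
      qc-rc = trans (cong ∣_∣ (solve 3 (λ q r c → q :* c :- r :* c := (q :- r) :* c) refl q r c))
        (trans (ℚₚ.∣p*q∣≡∣p∣*∣q∣ (q - r) c) (cong (D *_) (ℚₚ.0≤p⇒∣p∣≡p 0≤c)))

    ∣+-+∣≤ : ∀ u v u′ v′ → ∣ (u + v) - (u′ + v′) ∣ ≤ ∣ u - u′ ∣ + ∣ v - v′ ∣
    ∣+-+∣≤ u v u′ v′ = subst (λ t → ∣ t ∣ ≤ ∣ u - u′ ∣ + ∣ v - v′ ∣)
      (solve 4 (λ u v u′ v′ → (u :- u′) :+ (v :- v′) := (u :+ v) :- (u′ :+ v′)) refl u v u′ v′)
      (ℚₚ.∣p+q∣≤∣p∣+∣q∣ (u - u′) (v - v′))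

    expPartial-lipschitz-suc : ∀ {q r} → ∣ q ∣ ≤ K → ∣ r ∣ ≤ K → ∀ n →
      ∣ expPartial (suc n) q - expPartial (suc n) r ∣ ≤ ∣ q - r ∣ * expPartial n K
    expPartial-lipschitz-suc {q} {r} q≤K r≤K n = begin
      ∣ expPartial (suc n) q - expPartial (suc n) r ∣
        ≡⟨ cong₂ (λ u v → ∣ u - v ∣) (expPartial-suc n q) (expPartial-suc n r) ⟩
      ∣ (expPartial n q + expTerm q (suc n)) - (expPartial n r + expTerm r (suc n)) ∣
        ≤⟨ ∣+-+∣≤ (expPartial n q) (expTerm q (suc n)) (expPartial n r) (expTerm r (suc n)) ⟩
      ∣ expPartial n q - expPartial n r ∣ + ∣ expTerm q (suc n) - expTerm r (suc n) ∣
        ≤⟨ ℚₚ.+-monoʳ-≤ ∣ expPartial n q - expPartial n r ∣ (expTerm-lipschitz q≤K r≤K n) ⟩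
      ∣ expPartial n q - expPartial n r ∣ + ∣ q - r ∣ * expTerm K n
        ≤⟨ add n ⟩
      ∣ q - r ∣ * expPartial n K ∎
      where
      add : ∀ n → ∣ expPartial n q - expPartial n r ∣ + ∣ q - r ∣ * expTerm K n
                  ≤ ∣ q - r ∣ * expPartial n K
      add zero = ℚₚ.≤-reflexive (ℚₚ.+-identityˡ (∣ q - r ∣ * 1ℚ))
      add (suc n) = begin
        ∣ expPartial (suc n) q - expPartial (suc n) r ∣ + ∣ q - r ∣ * expTerm K (suc n)
          ≤⟨ ℚₚ.+-monoˡ-≤ (∣ q - r ∣ * expTerm K (suc n)) (expPartial-lipschitz-suc q≤K r≤K n) ⟩
        ∣ q - r ∣ * expPartial n K + ∣ q - r ∣ * expTerm K (suc n)
          ≡⟨ sym (ℚₚ.*-distribˡ-+ ∣ q - r ∣ (expPartial n K) (expTerm K (suc n))) ⟩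
        ∣ q - r ∣ * (expPartial n K + expTerm K (suc n))
          ≡⟨ cong (∣ q - r ∣ *_) (sym (expPartial-suc n K)) ⟩
        ∣ q - r ∣ * expPartial (suc n) K ∎

    expPartial-lipschitz : ∀ {q r} → ∣ q ∣ ≤ K → ∣ r ∣ ≤ K → ∀ n →
      ∣ expPartial n q - expPartial n r ∣ ≤ ∣ q - r ∣ * expPartial n K
    expPartial-lipschitz {q} {r} _ _ zero = 0≤* (ℚₚ.0≤∣p∣ (q - r)) (0≤expPartial 0)
    expPartial-lipschitz {q} {r} q≤K r≤K (suc n) = ℚₚ.≤-trans
      (expPartial-lipschitz-suc q≤K r≤K n)
      (*-mono (0≤expPartial n) (ℚₚ.0≤∣p∣ (q - r)) ℚₚ.≤-refl (expPartial-mono n))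

    halving : ∃[ L ] (∀ j → L ℕ.≤ j → K * recip (suc j) ≤ ½)
    halving =
      let D , 0<D , KD≡1 = inverse 0<K
          L , small      = archimedean (D * ½) (0<* 0<D (ℚₚ.positive⁻¹ ½))
      in L , λ j L≤j → begin
        K * recip (suc j)   ≤⟨ *-mono (ℚₚ.<⇒≤ (0<recip (suc j))) 0≤K ℚₚ.≤-refl (small j L≤j) ⟩
        K * (D * ½)         ≡⟨ sym (ℚₚ.*-assoc K D ½) ⟩
        (K * D) * ½         ≡⟨ cong (_* ½) KD≡1 ⟩
        1ℚ * ½              ≡⟨⟩
        ½                   ∎

    module _ {L : ℕ} (half : ∀ j → L ℕ.≤ j → K * recip (suc j) ≤ ½) where

      expTerm-half : ∀ j → L ℕ.≤ j → expTerm K (suc j) ≤ expTerm K j * ½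
      expTerm-half j L≤j = subst (_≤ expTerm K j * ½) (sym (expTerm-suc K j))
        (*-mono (0≤factor j) (0≤expTerm j) ℚₚ.≤-refl (half j L≤j))

      expTerm-double : ∀ j → L ℕ.≤ j → expTerm K (suc j) + expTerm K (suc j) ≤ expTerm K j
      expTerm-double j L≤j = ℚₚ.≤-trans
        (ℚₚ.+-mono-≤ (expTerm-half j L≤j) (expTerm-half j L≤j))
        (ℚₚ.≤-reflexive (solve 1 (λ e → e :* con ½ :+ e :* con ½ := e) refl (expTerm K j)))

      expTerm-decreasing : ∀ i → expTerm K (i ℕ.+ L) ≤ expTerm K L
      expTerm-decreasing zero = ℚₚ.≤-refl
      expTerm-decreasing (suc i) = begin
        expTerm K (suc (i ℕ.+ L))        ≡⟨ sym (ℚₚ.+-identityˡ _) ⟩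
        0ℚ + expTerm K (suc (i ℕ.+ L))   ≤⟨ ℚₚ.+-monoˡ-≤ _ (0≤expTerm (suc (i ℕ.+ L))) ⟩
        expTerm K (suc (i ℕ.+ L)) + expTerm K (suc (i ℕ.+ L))
          ≤⟨ expTerm-double (i ℕ.+ L) (ℕₚ.m≤n+m L i) ⟩
        expTerm K (i ℕ.+ L)              ≤⟨ expTerm-decreasing i ⟩
        expTerm K L                      ∎

      tail+ : ∀ {q} → ∣ q ∣ ≤ K → ∀ N → L ℕ.≤ N → ∀ i →
        ∣ expPartial (i ℕ.+ N) q - expPartial N q ∣ + expTerm K (i ℕ.+ N) ≤ expTerm K N
      tail+ {q} q≤K N L≤N zero = ℚₚ.≤-reflexive (trans
        (cong (λ t → ∣ t ∣ + expTerm K N) (ℚₚ.+-inverseʳ (expPartial N q)))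
        (ℚₚ.+-identityˡ (expTerm K N)))
      tail+ {q} q≤K N L≤N (suc i) = begin
        ∣ expPartial (suc n) q - s ∣ + k′
          ≡⟨ cong (λ t → ∣ t - s ∣ + k′) (expPartial-suc n q) ⟩
        ∣ (expPartial n q + t) - s ∣ + k′
          ≡⟨ cong (λ t → ∣ t ∣ + k′)
               (solve 3 (λ p t s → (p :+ t) :- s := (p :- s) :+ t) refl (expPartial n q) t s) ⟩
        ∣ (expPartial n q - s) + t ∣ + k′
          ≤⟨ ℚₚ.+-monoˡ-≤ k′ (ℚₚ.∣p+q∣≤∣p∣+∣q∣ (expPartial n q - s) t) ⟩
        (∣ expPartial n q - s ∣ + ∣ t ∣) + k′
          ≤⟨ ℚₚ.+-monoˡ-≤ k′ (ℚₚ.+-monoʳ-≤ ∣ expPartial n q - s ∣ (∣expTerm∣≤ (suc n) q≤K)) ⟩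
        (∣ expPartial n q - s ∣ + k′) + k′
          ≡⟨ ℚₚ.+-assoc ∣ expPartial n q - s ∣ k′ k′ ⟩
        ∣ expPartial n q - s ∣ + (k′ + k′)
          ≤⟨ ℚₚ.+-monoʳ-≤ ∣ expPartial n q - s ∣
               (expTerm-double n (ℕₚ.≤-trans L≤N (ℕₚ.m≤n+m N i))) ⟩
        ∣ expPartial n q - s ∣ + expTerm K n
          ≤⟨ tail+ q≤K N L≤N i ⟩
        expTerm K N ∎
        where
        n : ℕ
        n = i ℕ.+ N
        s t k′ : ℚ
        s  = expPartial N q
        t  = expTerm q (suc n)
        k′ = expTerm K (suc n)

      expPartial-tail : ∀ {q} → ∣ q ∣ ≤ K → ∀ {N m} → L ℕ.≤ N → N ℕ.≤ m →
        ∣ expPartial m q - expPartial N q ∣ ≤ expTerm K N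
      expPartial-tail {q} q≤K {N} {m} L≤N N≤m =
        subst (λ m → ∣ expPartial m q - expPartial N q ∣ ≤ expTerm K N) (ℕₚ.m∸n+n≡m N≤m)
        (begin
          ∣ expPartial (i ℕ.+ N) q - expPartial N q ∣
            ≡⟨ sym (ℚₚ.+-identityʳ ∣ expPartial (i ℕ.+ N) q - expPartial N q ∣) ⟩
          ∣ expPartial (i ℕ.+ N) q - expPartial N q ∣ + 0ℚ
            ≤⟨ ℚₚ.+-monoʳ-≤ ∣ expPartial (i ℕ.+ N) q - expPartial N q ∣ (0≤expTerm (i ℕ.+ N)) ⟩
          ∣ expPartial (i ℕ.+ N) q - expPartial N q ∣ + expTerm K (i ℕ.+ N)
            ≤⟨ tail+ q≤K N L≤N i ⟩
          expTerm K N ∎)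
        where
        i : ℕ
        i = m ∸ N

      expPartial-bound : ∀ n → L ℕ.≤ n → expPartial n K ≤ expTerm K L + expPartial L K
      expPartial-bound n L≤n = begin
        expPartial n K
          ≡⟨ solve 2 (λ p q → p := (p :- q) :+ q) refl (expPartial n K) (expPartial L K) ⟩
        (expPartial n K - expPartial L K) + expPartial L K
          ≤⟨ ℚₚ.+-monoˡ-≤ (expPartial L K) (ℚₚ.≤-trans (p≤∣p∣ _)
               (expPartial-tail {K} (ℚₚ.≤-reflexive (ℚₚ.0≤p⇒∣p∣≡p 0≤K)) ℕₚ.≤-refl L≤n)) ⟩
        expTerm K L + expPartial L K ∎

      expTerm-null : ∀ ε → 0ℚ < ε →
        ∃[ N ] (∀ n → N ℕ.≤ n → expTerm K n ≤ (expTerm K L * K) * ε)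
      expTerm-null ε 0<ε =
        let M , small = archimedean ε 0<ε
        in suc (M ℕ.⊔ L) , λ where
          (suc n) (ℕ.s≤s ≤n) → begin
            expTerm K (suc n)                    ≡⟨ expTerm-suc K n ⟩
            expTerm K n * (K * recip (suc n))
              ≤⟨ *-mono (0≤factor n) (0≤expTerm L)
                   (subst (λ n → expTerm K n ≤ expTerm K L)
                     (ℕₚ.m∸n+n≡m (⊔₂ {M} {L} ≤n)) (expTerm-decreasing (n ∸ L)))
                   (*-mono (ℚₚ.<⇒≤ (0<recip (suc n))) 0≤K ℚₚ.≤-refl
                     (small n (⊔₁ {M} {L} ≤n))) ⟩
            expTerm K L * (K * ε)                ≡⟨ sym (ℚₚ.*-assoc (expTerm K L) K ε) ⟩
            (expTerm K L * K) * ε                ∎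

  exp-cauchy : ∀ s → Cauchy s → Cauchy (λ n → expPartial n (s n))
  exp-cauchy s c =
    let K , 0<K , P , s≤K = bounded s c
        L , half = halving 0<K
        k = expTerm K L * K
        B = expTerm K L + expPartial L K
        0≤k = 0≤* (0≤expTerm 0<K L) (ℚₚ.<⇒≤ 0<K)
        0≤B = 0≤+ (0≤expTerm 0<K L) (0≤expPartial 0<K L)
    in rescale (λ n → expPartial n (s n)) (1ℚ + (k + (B + k)))
         (ℚₚ.+-mono-<-≤ (ℚₚ.positive⁻¹ 1ℚ) (0≤+ 0≤k (0≤+ 0≤B 0≤k))) λ ε 0<ε →
      let M , near = c ε 0<ε
          T , tiny = expTerm-null 0<K half ε 0<ε
          N = (P ℕ.⊔ L) ℕ.⊔ (M ℕ.⊔ T)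
          N≤N = ℕₚ.≤-refl {N}
          PL≤N = ⊔₁ {P ℕ.⊔ L} {M ℕ.⊔ T} N≤N
          MT≤N = ⊔₂ {P ℕ.⊔ L} {M ℕ.⊔ T} N≤N
          P≤N = ⊔₁ {P} {L} PL≤N
          L≤N = ⊔₂ {P} {L} PL≤N
          M≤N = ⊔₁ {M} {T} MT≤N
          T≤N = ⊔₂ {M} {T} MT≤N
          tail = λ m (N≤m : N ℕ.≤ m) → ℚₚ.≤-trans
            (expPartial-tail 0<K half {s m} (s≤K m (ℕₚ.≤-trans P≤N N≤m)) L≤N N≤m)
            (tiny N T≤N)
          E = expPartial
      in N , λ m n N≤m N≤n → begin
        ∣ E m (s m) - E n (s n) ∣
          ≤⟨ ∣∣-triangle (E m (s m)) (E N (s m)) (E n (s n)) ⟩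
        ∣ E m (s m) - E N (s m) ∣ + ∣ E N (s m) - E n (s n) ∣
          ≤⟨ ℚₚ.+-mono-≤ (tail m N≤m) (∣∣-triangle (E N (s m)) (E N (s n)) (E n (s n))) ⟩
        k * ε + (∣ E N (s m) - E N (s n) ∣ + ∣ E N (s n) - E n (s n) ∣)
          ≤⟨ ℚₚ.+-monoʳ-≤ (k * ε) (ℚₚ.+-mono-≤
               (ℚₚ.≤-trans
                 (expPartial-lipschitz 0<K {s m} {s n} (s≤K m (ℕₚ.≤-trans P≤N N≤m))
                   (s≤K n (ℕₚ.≤-trans P≤N N≤n)) N)
                 (*-mono (0≤expPartial 0<K N) (ℚₚ.<⇒≤ 0<ε)
                   (near m n (ℕₚ.≤-trans M≤N N≤m) (ℕₚ.≤-trans M≤N N≤n))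
                   (expPartial-bound 0<K half N L≤N)))
               (subst (_≤ k * ε) (∣∣-sub-comm (E n (s n)) (E N (s n))) (tail n N≤n))) ⟩
        k * ε + (ε * B + k * ε)
          ≡⟨ sym (ℚₚ.+-identityˡ _) ⟩
        0ℚ + (k * ε + (ε * B + k * ε))
          ≤⟨ ℚₚ.+-monoˡ-≤ (k * ε + (ε * B + k * ε)) (ℚₚ.<⇒≤ 0<ε) ⟩
        ε + (k * ε + (ε * B + k * ε))
          ≡⟨ solve 3 (λ e k B → e :+ (k :* e :+ (e :* B :+ k :* e))
                      := (con 1ℚ :+ (k :+ (B :+ k))) :* e) refl ε k B ⟩
        (1ℚ + (k + (B + k))) * ε ∎

open CauchyProperties
  using (const-cauchy; neg-cauchy; abs-cauchy; +-cauchy; *-cauchy; exp-cauchy)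

record ℝ : Set where
  constructor mkℝ
  field
    seq    : ℕ → ℚ
    cauchy : Cauchy seq

open ℝ public

infix  8 -_
infixl 7 _*_
infixl 6 _+_ _-_
infix  4 _≈_ _≤_

record _≈_ (x y : ℝ) : Set where
  constructor mk≈
  field
    close : ∀ ε → 0ℚ ℚ.< ε →
      ∃[ N ] (∀ n → N ℕ.≤ n → ℚ.∣ seq x n ℚ.- seq y n ∣ ℚ.≤ ε)

record _≤_ (x y : ℝ) : Set where
  constructor mk≤
  field
    below : ∀ ε → 0ℚ ℚ.< ε →
      ∃[ N ] (∀ n → N ℕ.≤ n → seq x n ℚ.≤ seq y n ℚ.+ ε)

open _≈_ public
open _≤_ public

fromℚ : ℚ → ℝ
seq    (fromℚ q) _ = q
cauchy (fromℚ q)   = const-cauchy q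

fromNat : ℕ → ℝ
fromNat n = fromℚ (+ n ℚ./ 1)

0ℝ 1ℝ : ℝ
0ℝ = fromℚ 0ℚ
1ℝ = fromℚ 1ℚ

_+_ : ℝ → ℝ → ℝ
seq    (x + y) n = seq x n ℚ.+ seq y n
cauchy (x + y)   = +-cauchy (seq x) (seq y) (cauchy x) (cauchy y)

_*_ : ℝ → ℝ → ℝ
seq    (x * y) n = seq x n ℚ.* seq y n
cauchy (x * y)   = *-cauchy (seq x) (seq y) (cauchy x) (cauchy y)

-_ : ℝ → ℝ
seq    (- x) n = ℚ.- seq x n
cauchy (- x)   = neg-cauchy (seq x) (cauchy x)

_-_ : ℝ → ℝ → ℝ
x - y = x + (- y)

∣_∣ : ℝ → ℝ
seq    ∣ x ∣ n = ℚ.∣ seq x n ∣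
cauchy ∣ x ∣   = abs-cauchy (seq x) (cauchy x)

-- The diagonal sequence n ↦ Σ_{j ≤ n} xₙ^j / j! represents Σ_{j ≥ 0} x^j / j!,
-- since the series converges uniformly on bounded sets.
exp : ℝ → ℝ
seq    (exp x) n = expPartial n (seq x n)
cauchy (exp x)   = exp-cauchy (seq x) (cauchy x)

ℝ-rawRing : RawRing 0ℓ 0ℓ
ℝ-rawRing = record
  { Carrier = ℝ ; _≈_ = _≈_ ; _+_ = _+_ ; _*_ = _*_ ; -_ = -_ ; 0# = 0ℝ ; 1# = 1ℝ }

open RawSemiringDefs (RawRing.rawSemiring ℝ-rawRing) public using (_^_; sum)

record TaggedPartition (a b : ℝ) : Set where
  field
    size      : ℕ
    point     : Fin (suc size) → ℝ
    tag       : Fin size → ℝ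
    first     : point Fin.zero ≈ a
    last      : point (fromℕ size) ≈ b
    point≤tag : ∀ i → point (inject₁ i) ≤ tag i
    tag≤point : ∀ i → tag i ≤ point (Fin.suc i)

  width : Fin size → ℝ
  width i = point (Fin.suc i) - point (inject₁ i)

open TaggedPartition public

riemannSum : (ℝ → ℝ) → {a b : ℝ} → TaggedPartition a b → ℝ
riemannSum f P = sum (λ i → f (tag P i) * width P i)

-- Meaningful for a ≤ b. Rational ε and δ suffice, as ℚ is dense in ℝ.
IsRiemannIntegral : (ℝ → ℝ) → ℝ → ℝ → ℝ → Set
IsRiemannIntegral f a b I = ∀ ε → 0ℚ ℚ.< ε → ∃[ δ ] (0ℚ ℚ.< δ ×
  ((P : TaggedPartition a b) → (∀ i → width P i ≤ fromℚ δ) →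
    ∣ riemannSum f P - I ∣ ≤ fromℚ ε))

-- J b is the integral over [0, b]; the improper integral converges to I as b → ∞.
IsIntegral₀^∞ : (ℝ → ℝ) → ℝ → Set
IsIntegral₀^∞ f I = Σ[ J ∈ (∀ b → 0ℝ ≤ b → ℝ) ]
  ((∀ b (0≤b : 0ℝ ≤ b) → IsRiemannIntegral f 0ℝ b (J b 0≤b)) ×
   (∀ ε → 0ℚ ℚ.< ε → ∃[ B ] (∀ b (0≤b : 0ℝ ≤ b) → B ≤ b → ∣ J b 0≤b - I ∣ ≤ fromℚ ε)))

whitneyDenominator-nonZero : ∀ m .{{_ : NonZero m}} k → NonZero (m ℕ.^ k ℕ.* k !)
whitneyDenominator-nonZero m k =
  ℕₚ.m*n≢0 (m ℕ.^ k) (k !) {{ℕₚ.m^n≢0 m k}} {{k !≢0}}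

-- The power _^_ satisfies x ^ 0 = 1ℝ for every x, which is the convention 0⁰ = 1.
W̃ : (m : ℕ) .{{_ : NonZero m}} → ℝ → ℕ → ℕ → ℝ
W̃ m a n k = fromℚ (recip (m ℕ.^ k ℕ.* k !) {{whitneyDenominator-nonZero m k}}) *
  sum {suc k} (λ j →
    fromNat (k C toℕ j) * (- 1ℝ) ^ (k ∸ toℕ j) * (fromNat (m ℕ.* toℕ j) - a) ^ n)

F̃ : (m : ℕ) .{{_ : NonZero m}} → ℝ → ℕ → ℝ → ℝ
F̃ m a n x = sum {suc n} (λ k → fromNat (toℕ k !) * W̃ m a n (toℕ k) * x ^ toℕ k)

D̃ : (m : ℕ) .{{_ : NonZero m}} → ℝ → ℕ → ℝ → ℝ
D̃ m a n x = sum {suc n} (λ k → W̃ m a n (toℕ k) * x ^ toℕ k)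

-- Put P₀(t) = -e⁻ᵗ and P_{k+1}(t) = -t^{k+1} e⁻ᵗ + (k+1) P_k(t).  Then P_k′ = t^k e⁻ᵗ,
-- P_k(0) = -k!, and P_k vanishes at infinity, so the integral of t^k e⁻ᵗ over [0, ∞) is k!;
-- the statement follows by linearity.  Derivatives are used in the uniform form
-- |G y - G x - f x (y - x)| ≤ C |y - x|² on bounded sets: summed over a partition of mesh δ
-- this bounds the distance from a Riemann sum of f to G b - G 0 by C δ b.  The decay of P_k
-- comes from e⁻ᵇ eᵇ = 1 (the product has derivative zero) and eᵇ ≥ b^{k+1} / (k+1)!.

module Submission where

open import Algebra.Bundles using (CommutativeRing; RawRing)
open import Algebra.Solver.Ring.AlmostCommutativeRing
  using (fromCommutativeRing; _-Raw-AlmostCommutative⟶_)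
open import Data.Fin.Base as Fin using (Fin; toℕ; inject₁)
open import Data.Integer.Base as ℤ using (+_; +≤+)
open import Data.Nat.Base as ℕ using (ℕ; zero; suc; NonZero; _!)
open import Data.Product.Base using (∃-syntax; _×_; _,_; proj₁; proj₂)
open import Data.Rational.Base as ℚ using (ℚ; 0ℚ; 1ℚ; ½)
open import Level using (0ℓ)
open import Relation.Binary.Bundles using (Poset)
open import Relation.Binary.PropositionalEquality as ≡ using (_≡_; cong; cong₂; subst)
open import Relation.Nullary.Decidable using (dec⇒maybe)
import Algebra.Consequences.Setoid as Consequences
import Algebra.Definitions.RawSemiring as RawSemiringDefs
import Algebra.Properties.Semiring.Sum as SemiringSum
import Algebra.Solver.Ring as RingSolver
import Data.Integer.Properties as ℤₚ
import Data.Maybe.Base as Maybe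
import Data.Nat.Properties as ℕₚ
import Data.Rational.Properties as ℚₚ
import Data.Rational.Solver as ℚ-Solver
import Data.Rational.Unnormalised.Base as ℚᵘ
import Data.Rational.Unnormalised.Properties as ℚᵘₚ
import Defs
import Relation.Binary.Reasoning.PartialOrder as PartialOrderReasoning

open Defs.CauchyProperties hiding (*-cauchy; 0≤expTerm; 0≤expPartial)

-- The order on the reals is undecidable and a function acts on representatives, so neither case
-- splits on signs nor intermediate points are at hand. Every estimate therefore carries explicit
-- constants, and compatibility of a function with `_≈_` is itself deduced from a Lipschitz bound.
-- The position `n` of the sequence of `exp x` is the `n`-th partial sum at the `n`-th approximation
-- of `x`. Hence each inequality about `exp` is proved for rational partial sums with a constant
-- independent of `n` and then read off along that diagonal; the rational Taylor remainders serve
-- this purpose. That a function with zero derivative is constant comes from repeated bisection,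
-- which the quadratic remainder makes possible. The coefficient of the `k`-th power of λ in the
-- Dowling polynomial at xλ is `W̃ m a n k * x ^ k`, and integration multiplies it by `k !`, giving
-- the `k`-th summand of `F̃`. The integration is accordingly done for an arbitrary coefficient
-- sequence `w` and specialised at the end.

module ExponentialSeries where

  open import Data.Rational.Base using (_+_; _*_; _-_; -_; ∣_∣; _≤_; _<_)
  open Defs using (expTerm; expPartial; recip)
  open Defs.ℚSemiring using (_^_)
  open ℚₚ.≤-Reasoning
  open ℚ-Solver.+-*-Solver using (solve; _:+_; _:*_; _:-_; :-_; _:=_; con)

  -- Rational arithmetic and the terms of the exponential series

  fromℕ : ℕ → ℚ
  fromℕ n = + n ℚ./ 1

  0≤fromℕ : ∀ n → 0ℚ ≤ fromℕ n
  0≤fromℕ zero = ℚₚ.≤-refl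
  0≤fromℕ (suc n) = subst (0ℚ ≤_) (≡.sym (fromℕ-suc n))
    (0≤+ (ℚₚ.<⇒≤ (ℚₚ.positive⁻¹ 1ℚ)) (0≤fromℕ n))

  0<fromℕ-suc : ∀ n → 0ℚ < fromℕ (suc n)
  0<fromℕ-suc n = subst (0ℚ <_) (≡.sym (fromℕ-suc n))
    (ℚₚ.+-mono-<-≤ (ℚₚ.positive⁻¹ 1ℚ) (0≤fromℕ n))

  fromℕ-* : ∀ m n → fromℕ (m ℕ.* n) ≡ fromℕ m * fromℕ n
  fromℕ-* m n = ℚₚ.toℚᵘ-injective (ℚᵘₚ.≃-trans (toℚᵘ-/ (+ (m ℕ.* n)) 0)
    (ℚᵘₚ.≃-sym (ℚᵘₚ.≃-trans (ℚₚ.toℚᵘ-homo-* (fromℕ m) (fromℕ n))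
      (ℚᵘₚ.≃-trans (ℚᵘₚ.*-cong (toℚᵘ-/ (+ m) 0) (toℚᵘ-/ (+ n) 0))
        (ℚᵘ.*≡* (cong (ℤ._* + 1) (≡.sym (ℤₚ.pos-* m n))))))))

  0≤½^ : ∀ n → 0ℚ ≤ ½ ^ n
  0≤½^ zero = ℚₚ.<⇒≤ (ℚₚ.positive⁻¹ 1ℚ)
  0≤½^ (suc n) = 0≤* (ℚₚ.<⇒≤ (ℚₚ.positive⁻¹ ½)) (0≤½^ n)

  -- This is `n + 1 ≤ 2 ^ n`, kept free of division. In the induction step the left side is the mean
  -- of `½ ^ n` and the preceding left side, both at most 1.
  suc-*-½^≤1 : ∀ n → fromℕ (suc n) * ½ ^ n ≤ 1ℚ
  suc-*-½^≤1 zero = ℚₚ.≤-refl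
  suc-*-½^≤1 (suc n) = begin
    fromℕ (2 ℕ.+ n) * (½ * p)
      ≡⟨ cong (_* (½ * p)) (fromℕ-suc (suc n)) ⟩
    (1ℚ + fromℕ (suc n)) * (½ * p)
      ≡⟨ solve 3 (λ n h p → (con 1ℚ :+ n) :* (h :* p) := h :* (p :+ n :* p)) ≡.refl
           (fromℕ (suc n)) ½ p ⟩
    ½ * (p + fromℕ (suc n) * p)
      ≤⟨ ℚₚ.*-monoˡ-≤-nonNeg ½ (ℚₚ.+-mono-≤ (½^≤1 n) (suc-*-½^≤1 n)) ⟩
    ½ * (1ℚ + 1ℚ) ∎
    where
    p : ℚ
    p = ½ ^ n
    ½≤1 : ½ ≤ 1ℚ
    ½≤1 = ℚ.*≤* (+≤+ (ℕ.s≤s ℕ.z≤n))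
    ½^≤1 : ∀ n → ½ ^ n ≤ 1ℚ
    ½^≤1 zero = ℚₚ.≤-refl
    ½^≤1 (suc n) = *-mono (0≤½^ n) (ℚₚ.<⇒≤ (ℚₚ.positive⁻¹ 1ℚ))
      ½≤1 (½^≤1 n)

  -- Lets the archimedean property, stated for `recip`, control the halving factor of the bisection
  -- in `zero-derivative⇒constant`.
  ½^≤recip : ∀ n → ½ ^ n ≤ recip (suc n)
  ½^≤recip n = begin
    ½ ^ n                                   ≡⟨ ≡.sym (ℚₚ.*-identityˡ (½ ^ n)) ⟩
    1ℚ * ½ ^ n                              ≡⟨ cong (_* ½ ^ n) (≡.sym (recip-inverse (suc n))) ⟩
    (recip (suc n) * fromℕ (suc n)) * ½ ^ n ≡⟨ ℚₚ.*-assoc (recip (suc n)) (fromℕ (suc n)) (½ ^ n) ⟩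
    recip (suc n) * (fromℕ (suc n) * ½ ^ n)
      ≤⟨ *-mono (0≤* (0≤fromℕ (suc n)) (0≤½^ n)) (ℚₚ.<⇒≤ (0<recip (suc n))) ℚₚ.≤-refl (suc-*-½^≤1 n) ⟩
    recip (suc n) * 1ℚ                      ≡⟨ ℚₚ.*-identityʳ (recip (suc n)) ⟩
    recip (suc n)                           ∎

  -- The recurrence of the terms with the reciprocal cleared. Multiplied by `suc j`, statements
  -- about the terms become ring identities, and the factor is cancelled at the end.
  suc-*-expTerm : ∀ q j → fromℕ (suc j) * expTerm q (suc j) ≡ q * expTerm q j
  suc-*-expTerm q j = begin-equality
    fromℕ (suc j) * expTerm q (suc j)
      ≡⟨ cong (fromℕ (suc j) *_) (expTerm-suc q j) ⟩
    fromℕ (suc j) * (expTerm q j * (q * recip (suc j)))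
      ≡⟨ solve 4 (λ n e q r → n :* (e :* (q :* r)) := (r :* n) :* (q :* e)) ≡.refl
           (fromℕ (suc j)) (expTerm q j) q (recip (suc j)) ⟩
    (recip (suc j) * fromℕ (suc j)) * (q * expTerm q j)
      ≡⟨ cong (_* (q * expTerm q j)) (recip-inverse (suc j)) ⟩
    1ℚ * (q * expTerm q j)
      ≡⟨ ℚₚ.*-identityˡ _ ⟩
    q * expTerm q j ∎

  0≤expTerm : ∀ {q} → 0ℚ ≤ q → ∀ j → 0ℚ ≤ expTerm q j
  0≤expTerm 0≤q zero = ℚₚ.<⇒≤ (ℚₚ.positive⁻¹ 1ℚ)
  0≤expTerm {q} 0≤q (suc j) = subst (0ℚ ≤_) (≡.sym (expTerm-suc q j))
    (0≤* (0≤expTerm 0≤q j) (0≤* 0≤q (ℚₚ.<⇒≤ (0<recip (suc j)))))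

  0≤expPartial : ∀ {q} → 0ℚ ≤ q → ∀ n → 0ℚ ≤ expPartial n q
  0≤expPartial 0≤q zero = ℚₚ.<⇒≤ (ℚₚ.positive⁻¹ 1ℚ)
  0≤expPartial {q} 0≤q (suc n) = subst (0ℚ ≤_) (≡.sym (expPartial-suc n q))
    (0≤+ (0≤expPartial 0≤q n) (0≤expTerm 0≤q (suc n)))

  expTerm≤expPartial-self : ∀ {q} → 0ℚ ≤ q → ∀ k → expTerm q k ≤ expPartial k q
  expTerm≤expPartial-self 0≤q zero = ℚₚ.≤-refl
  expTerm≤expPartial-self {q} 0≤q (suc k) = begin
    expTerm q (suc k)                    ≡⟨ ≡.sym (ℚₚ.+-identityˡ _) ⟩
    0ℚ + expTerm q (suc k)               ≤⟨ ℚₚ.+-monoˡ-≤ _ (0≤expPartial 0≤q k) ⟩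
    expPartial k q + expTerm q (suc k)   ≡⟨ ≡.sym (expPartial-suc k q) ⟩
    expPartial (suc k) q                 ∎

  -- All terms at a nonnegative argument are nonnegative, so a later partial sum dominates each
  -- single term. This is the source of the lower bound `^≤exp`.
  expTerm≤expPartial : ∀ {q} → 0ℚ ≤ q → ∀ k i → expTerm q k ≤ expPartial (i ℕ.+ k) q
  expTerm≤expPartial 0≤q k zero = expTerm≤expPartial-self 0≤q k
  expTerm≤expPartial {q} 0≤q k (suc i) = begin
    expTerm q k                                        ≤⟨ expTerm≤expPartial 0≤q k i ⟩
    expPartial (i ℕ.+ k) q                             ≡⟨ ≡.sym (ℚₚ.+-identityʳ _) ⟩
    expPartial (i ℕ.+ k) q + 0ℚ
      ≤⟨ ℚₚ.+-monoʳ-≤ (expPartial (i ℕ.+ k) q) (0≤expTerm 0≤q (suc (i ℕ.+ k))) ⟩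
    expPartial (i ℕ.+ k) q + expTerm q (suc (i ℕ.+ k)) ≡⟨ ≡.sym (expPartial-suc (i ℕ.+ k) q) ⟩
    expPartial (suc i ℕ.+ k) q                         ∎

  module _ {K : ℚ} (0<K : 0ℚ < K) where

    ∣expPartial∣≤ : ∀ {q} → ∣ q ∣ ≤ K → ∀ n → ∣ expPartial n q ∣ ≤ expPartial n K
    ∣expPartial∣≤ q≤K zero = ℚₚ.≤-refl
    ∣expPartial∣≤ {q} q≤K (suc n) = begin
      ∣ expPartial (suc n) q ∣                      ≡⟨ cong ∣_∣ (expPartial-suc n q) ⟩
      ∣ expPartial n q + expTerm q (suc n) ∣
        ≤⟨ ℚₚ.∣p+q∣≤∣p∣+∣q∣ (expPartial n q) (expTerm q (suc n)) ⟩
      ∣ expPartial n q ∣ + ∣ expTerm q (suc n) ∣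
        ≤⟨ ℚₚ.+-mono-≤ (∣expPartial∣≤ q≤K n) (∣expTerm∣≤ 0<K (suc n) q≤K) ⟩
      expPartial n K + expTerm K (suc n)            ≡⟨ ≡.sym (expPartial-suc n K) ⟩
      expPartial (suc n) K                          ∎

    -- First-order Taylor expansion of the partial sums

    module _ {x y : ℚ} (x≤K : ∣ x ∣ ≤ K) (y≤K : ∣ y ∣ ≤ K) where

      private
        h H : ℚ
        h = y - x
        H = ∣ h ∣ * ∣ h ∣

        0≤H : 0ℚ ≤ H
        0≤H = 0≤* (ℚₚ.0≤∣p∣ h) (ℚₚ.0≤∣p∣ h)

      termRemainder : ℕ → ℚ
      termRemainder j = expTerm y (suc j) - expTerm x (suc j) - expTerm x j * h

      -- Raising the degree multiplies the old remainder by `y` and adds an explicit multiple of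
      -- `h * h`. As the remainder of the linear term is 0, every remainder is thereby of second
      -- order in `h`.
      termRemainder-suc : ∀ j → fromℕ (2 ℕ.+ j) * termRemainder (suc j)
        ≡ y * termRemainder j + (h * h) * expTerm x j
      termRemainder-suc j = begin-equality
        n₂ * (y₂ - x₂ - x₁ * h)
          ≡⟨ solve 5 (λ n y₂ x₂ x₁ h →
               n :* (y₂ :- x₂ :- x₁ :* h) := n :* y₂ :- n :* x₂ :- n :* (x₁ :* h))
               ≡.refl n₂ y₂ x₂ x₁ h ⟩
        n₂ * y₂ - n₂ * x₂ - n₂ * (x₁ * h)
          ≡⟨ cong₂ (λ u v → u - v - n₂ * (x₁ * h)) (suc-*-expTerm y (suc j)) (suc-*-expTerm x (suc j)) ⟩
        y * y₁ - x * x₁ - n₂ * (x₁ * h)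
          ≡⟨ cong (λ t → y * y₁ - x * x₁ - t * (x₁ * h)) (fromℕ-suc (suc j)) ⟩
        y * y₁ - x * x₁ - (1ℚ + n₁) * (x₁ * h)
          ≡⟨ solve 5 (λ x y n x₁ y₁ →
               y :* y₁ :- x :* x₁ :- (con 1ℚ :+ n) :* (x₁ :* (y :- x))
               := y :* y₁ :- y :* x₁ :- (n :* x₁) :* (y :- x)) ≡.refl x y n₁ x₁ y₁ ⟩
        y * y₁ - y * x₁ - (n₁ * x₁) * h
          ≡⟨ cong (λ t → y * y₁ - y * x₁ - t * h) (suc-*-expTerm x j) ⟩
        y * y₁ - y * x₁ - (x * x₀) * h
          ≡⟨ solve 5 (λ x y x₀ x₁ y₁ →
               y :* y₁ :- y :* x₁ :- (x :* x₀) :* (y :- x)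
               := y :* (y₁ :- x₁ :- x₀ :* (y :- x)) :+ ((y :- x) :* (y :- x)) :* x₀)
               ≡.refl x y x₀ x₁ y₁ ⟩
        y * (y₁ - x₁ - x₀ * h) + (h * h) * x₀ ∎
        where
        n₁ n₂ x₀ x₁ x₂ y₁ y₂ : ℚ
        n₁ = fromℕ (suc j)
        n₂ = fromℕ (2 ℕ.+ j)
        x₀ = expTerm x j
        x₁ = expTerm x (suc j)
        x₂ = expTerm x (2 ℕ.+ j)
        y₁ = expTerm y (suc j)
        y₂ = expTerm y (2 ℕ.+ j)

      termRemainder-zero : termRemainder 0 ≡ 0ℚ
      termRemainder-zero = solve 2 (λ x y →
        (y :* con 1ℚ) :* con 1ℚ :- (x :* con 1ℚ) :* con 1ℚ :- (con 1ℚ :* con 1ℚ) :* (y :- x)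
        := con 0ℚ) ≡.refl x y

      -- The bound `r` is left free so that one step serves both cases below: `r = 0` at the start,
      -- where the remainder vanishes, and `r` the preceding term afterwards, where `K * r` is a
      -- multiple of the current term. The recursion then has total weight at most `n₁ + 1 = n₂`,
      -- which cancels.
      ∣termRemainder∣-step : ∀ j {r} → ∣ termRemainder j ∣ ≤ r * H →
        K * r ≤ fromℕ (suc j) * expTerm K j → ∣ termRemainder (suc j) ∣ ≤ expTerm K j * H
      ∣termRemainder∣-step j {r} R≤ Kr≤ =
        ℚₚ.*-cancelˡ-≤-pos n₂ {{ℚ.positive (0<fromℕ-suc (suc j))}} (begin
          n₂ * ∣ termRemainder (suc j) ∣
            ≡⟨ cong (_* ∣ termRemainder (suc j) ∣)
                 (≡.sym (ℚₚ.0≤p⇒∣p∣≡p (0≤fromℕ (2 ℕ.+ j)))) ⟩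
          ∣ n₂ ∣ * ∣ termRemainder (suc j) ∣
            ≡⟨ ≡.sym (ℚₚ.∣p*q∣≡∣p∣*∣q∣ n₂ (termRemainder (suc j))) ⟩
          ∣ n₂ * termRemainder (suc j) ∣
            ≡⟨ cong ∣_∣ (termRemainder-suc j) ⟩
          ∣ y * termRemainder j + (h * h) * expTerm x j ∣
            ≤⟨ ℚₚ.∣p+q∣≤∣p∣+∣q∣ (y * termRemainder j) ((h * h) * expTerm x j) ⟩
          ∣ y * termRemainder j ∣ + ∣ (h * h) * expTerm x j ∣
            ≡⟨ cong₂ _+_ (ℚₚ.∣p*q∣≡∣p∣*∣q∣ y _)
                 (≡.trans (ℚₚ.∣p*q∣≡∣p∣*∣q∣ (h * h) _)
                   (cong (_* ∣ expTerm x j ∣) (ℚₚ.∣p*q∣≡∣p∣*∣q∣ h h))) ⟩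
          ∣ y ∣ * ∣ termRemainder j ∣ + H * ∣ expTerm x j ∣
            ≤⟨ ℚₚ.+-mono-≤
                 (*-mono (ℚₚ.0≤∣p∣ (termRemainder j)) (ℚₚ.<⇒≤ 0<K) y≤K R≤)
                 (*-mono (ℚₚ.0≤∣p∣ (expTerm x j)) 0≤H ℚₚ.≤-refl (∣expTerm∣≤ 0<K j x≤K)) ⟩
          K * (r * H) + H * e
            ≡⟨ solve 4 (λ K r H e → K :* (r :* H) :+ H :* e := (K :* r) :* H :+ H :* e)
                 ≡.refl K r H e ⟩
          (K * r) * H + H * e
            ≤⟨ ℚₚ.+-monoˡ-≤ (H * e) (*-mono 0≤H
                 (0≤* (0≤fromℕ (suc j)) (0≤expTerm (ℚₚ.<⇒≤ 0<K) j)) Kr≤ ℚₚ.≤-refl) ⟩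
          (n₁ * e) * H + H * e
            ≡⟨ solve 3 (λ n H e → (n :* e) :* H :+ H :* e := (con 1ℚ :+ n) :* (e :* H))
                 ≡.refl n₁ H e ⟩
          (1ℚ + n₁) * (e * H)
            ≡⟨ cong (_* (e * H)) (≡.sym (fromℕ-suc (suc j))) ⟩
          n₂ * (e * H) ∎)
        where
        n₁ n₂ e : ℚ
        n₁ = fromℕ (suc j)
        n₂ = fromℕ (2 ℕ.+ j)
        e  = expTerm K j

      ∣termRemainder∣≤ : ∀ j → ∣ termRemainder (suc j) ∣ ≤ expTerm K j * H
      ∣termRemainder∣≤ zero = ∣termRemainder∣-step 0 {0ℚ}
        (ℚₚ.≤-reflexive (≡.trans (cong ∣_∣ termRemainder-zero) (≡.sym (ℚₚ.*-zeroˡ H))))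
        (ℚₚ.≤-trans (ℚₚ.≤-reflexive (ℚₚ.*-zeroʳ K)) (ℚₚ.<⇒≤ (ℚₚ.positive⁻¹ 1ℚ)))
      ∣termRemainder∣≤ (suc j) = ∣termRemainder∣-step (suc j) (∣termRemainder∣≤ j) (begin
        K * expTerm K j                        ≡⟨ ≡.sym (suc-*-expTerm K j) ⟩
        fromℕ (suc j) * e′
          ≤⟨ *-mono (0≤expTerm (ℚₚ.<⇒≤ 0<K) (suc j)) (0≤fromℕ (2 ℕ.+ j)) n≤1+n ℚₚ.≤-refl ⟩
        fromℕ (2 ℕ.+ j) * e′                   ∎)
        where
        e′ : ℚ
        e′ = expTerm K (suc j)
        n≤1+n : fromℕ (suc j) ≤ fromℕ (2 ℕ.+ j)
        n≤1+n = begin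
          fromℕ (suc j)          ≡⟨ ≡.sym (ℚₚ.+-identityˡ _) ⟩
          0ℚ + fromℕ (suc j)     ≤⟨ ℚₚ.+-monoˡ-≤ (fromℕ (suc j)) (ℚₚ.<⇒≤ (ℚₚ.positive⁻¹ 1ℚ)) ⟩
          1ℚ + fromℕ (suc j)     ≡⟨ ≡.sym (fromℕ-suc (suc j)) ⟩
          fromℕ (2 ℕ.+ j)        ∎

      partialRemainder : ℕ → ℚ
      partialRemainder n = expPartial (suc n) y - expPartial (suc n) x - expPartial n x * h

      partialRemainder-suc : ∀ n →
        partialRemainder (suc n) ≡ partialRemainder n + termRemainder (suc n)
      partialRemainder-suc n = begin-equality
        expPartial (2 ℕ.+ n) y - expPartial (2 ℕ.+ n) x - expPartial (suc n) x * h
          ≡⟨ cong (λ t → expPartial (2 ℕ.+ n) y - expPartial (2 ℕ.+ n) x - t * h) (expPartial-suc n x) ⟩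
        expPartial (2 ℕ.+ n) y - expPartial (2 ℕ.+ n) x - (x₀ + t₀) * h
          ≡⟨ cong₂ (λ u v → u - v - (x₀ + t₀) * h) (expPartial-suc (suc n) y) (expPartial-suc (suc n) x) ⟩
        (y₁ + s₁) - (x₁ + t₁) - (x₀ + t₀) * h
          ≡⟨ solve 7 (λ y₁ s₁ x₁ t₁ x₀ t₀ h →
               (y₁ :+ s₁) :- (x₁ :+ t₁) :- (x₀ :+ t₀) :* h
               := (y₁ :- x₁ :- x₀ :* h) :+ (s₁ :- t₁ :- t₀ :* h))
               ≡.refl y₁ s₁ x₁ t₁ x₀ t₀ h ⟩
        (y₁ - x₁ - x₀ * h) + (s₁ - t₁ - t₀ * h) ∎
        where
        x₀ x₁ y₁ t₀ t₁ s₁ : ℚ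
        x₀ = expPartial n x
        x₁ = expPartial (suc n) x
        y₁ = expPartial (suc n) y
        t₀ = expTerm x (suc n)
        t₁ = expTerm x (2 ℕ.+ n)
        s₁ = expTerm y (2 ℕ.+ n)

      -- The term remainder of index `suc n` is bounded by `expTerm K n`, one index behind. The
      -- induction carries that term as slack on the left, spends it on the new remainder and
      -- replaces it by the next one.
      ∣partialRemainder∣+ : ∀ n →
        ∣ partialRemainder n ∣ + expTerm K n * H ≤ expPartial n K * H
      ∣partialRemainder∣+ zero = ℚₚ.≤-reflexive (begin-equality
        ∣ partialRemainder 0 ∣ + 1ℚ * H
          ≡⟨ cong (λ t → ∣ t ∣ + 1ℚ * H) (solve 2 (λ x y →
               (con 1ℚ :+ ((y :* con 1ℚ) :* con 1ℚ :+ con 0ℚ))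
               :- (con 1ℚ :+ ((x :* con 1ℚ) :* con 1ℚ :+ con 0ℚ))
               :- con 1ℚ :* (y :- x) := con 0ℚ) ≡.refl x y) ⟩
        0ℚ + 1ℚ * H
          ≡⟨ ℚₚ.+-identityˡ _ ⟩
        1ℚ * H ∎)
      ∣partialRemainder∣+ (suc n) = begin
        ∣ partialRemainder (suc n) ∣ + e′ * H
          ≡⟨ cong (λ t → ∣ t ∣ + e′ * H) (partialRemainder-suc n) ⟩
        ∣ partialRemainder n + termRemainder (suc n) ∣ + e′ * H
          ≤⟨ ℚₚ.+-monoˡ-≤ (e′ * H) (ℚₚ.∣p+q∣≤∣p∣+∣q∣ (partialRemainder n) _) ⟩
        (∣ partialRemainder n ∣ + ∣ termRemainder (suc n) ∣) + e′ * H
          ≤⟨ ℚₚ.+-monoˡ-≤ (e′ * H) (ℚₚ.+-monoʳ-≤ ∣ partialRemainder n ∣ (∣termRemainder∣≤ n)) ⟩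
        (∣ partialRemainder n ∣ + expTerm K n * H) + e′ * H
          ≤⟨ ℚₚ.+-monoˡ-≤ (e′ * H) (∣partialRemainder∣+ n) ⟩
        expPartial n K * H + e′ * H
          ≡⟨ ≡.sym (ℚₚ.*-distribʳ-+ H (expPartial n K) e′) ⟩
        (expPartial n K + e′) * H
          ≡⟨ cong (_* H) (≡.sym (expPartial-suc n K)) ⟩
        expPartial (suc n) K * H ∎
        where
        e′ : ℚ
        e′ = expTerm K (suc n)

      ∣partialRemainder∣≤ : ∀ n → ∣ partialRemainder n ∣ ≤ expPartial n K * H
      ∣partialRemainder∣≤ n = ℚₚ.≤-trans
        (ℚₚ.≤-trans (ℚₚ.≤-reflexive (≡.sym (ℚₚ.+-identityʳ _)))
          (ℚₚ.+-monoʳ-≤ ∣ partialRemainder n ∣ (0≤* (0≤expTerm (ℚₚ.<⇒≤ 0<K) n) 0≤H)))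
        (∣partialRemainder∣+ n)

      -- The derivative of expPartial (suc n) is expPartial n; the top term it lacks is bounded
      -- by the last summand.
      expPartial-taylor : ∀ n →
        ∣ expPartial (suc n) y - expPartial (suc n) x - expPartial (suc n) x * h ∣
          ≤ expPartial n K * H + expTerm K (suc n) * (K + K)
      expPartial-taylor n = begin
        ∣ y₁ - x₁ - x₁ * h ∣
          ≡⟨ cong (λ t → ∣ y₁ - x₁ - t * h ∣) (expPartial-suc n x) ⟩
        ∣ y₁ - x₁ - (x₀ + t) * h ∣
          ≡⟨ cong ∣_∣ (solve 5 (λ y₁ x₁ x₀ t h →
               y₁ :- x₁ :- (x₀ :+ t) :* h := (y₁ :- x₁ :- x₀ :* h) :+ (:- t) :* h)
               ≡.refl y₁ x₁ x₀ t h) ⟩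
        ∣ partialRemainder n + (- t) * h ∣
          ≤⟨ ℚₚ.∣p+q∣≤∣p∣+∣q∣ (partialRemainder n) _ ⟩
        ∣ partialRemainder n ∣ + ∣ (- t) * h ∣
          ≡⟨ cong (_+_ ∣ partialRemainder n ∣) (≡.trans (ℚₚ.∣p*q∣≡∣p∣*∣q∣ (- t) h)
               (cong (_* ∣ h ∣) (ℚₚ.∣-p∣≡∣p∣ t))) ⟩
        ∣ partialRemainder n ∣ + ∣ t ∣ * ∣ h ∣
          ≤⟨ ℚₚ.+-mono-≤ (∣partialRemainder∣≤ n)
               (*-mono (ℚₚ.0≤∣p∣ h) (0≤expTerm (ℚₚ.<⇒≤ 0<K) (suc n)) (∣expTerm∣≤ 0<K (suc n) x≤K) h≤) ⟩
        expPartial n K * H + expTerm K (suc n) * (K + K) ∎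
        where
        x₀ x₁ y₁ t : ℚ
        x₀ = expPartial n x
        x₁ = expPartial (suc n) x
        y₁ = expPartial (suc n) y
        t  = expTerm x (suc n)
        h≤ : ∣ h ∣ ≤ K + K
        h≤ = ℚₚ.≤-trans (ℚₚ.∣p-q∣≤∣p∣+∣q∣ y x) (ℚₚ.+-mono-≤ y≤K x≤K)

-- Order and arithmetic of the Cauchy reals

module RealOrder where

  open Defs using (ℝ; seq; cauchy; _≈_; mk≈; close; _≤_; mk≤; below)
  open ℚₚ.≤-Reasoning
  open ℚ-Solver.+-*-Solver using (solve; _:+_; _:*_; _:-_; :-_; _:=_; con)

  infix  8 -_
  infixl 7 _*_
  infixl 6 _+_ _-_

  -- The operations of Defs are given by copatterns, so that conversion checking
  -- would compare reals componentwise; the opaque copies are compared by syntax.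
  opaque

    fromℚ : ℚ → ℝ
    fromℚ = Defs.fromℚ

    _+_ _*_ : ℝ → ℝ → ℝ
    _+_ = Defs._+_
    _*_ = Defs._*_

    -_ ∣_∣ exp : ℝ → ℝ
    -_  = Defs.-_
    ∣_∣ = Defs.∣_∣
    exp = Defs.exp

  _-_ : ℝ → ℝ → ℝ
  x - y = x + (- y)

  0ℝ 1ℝ : ℝ
  0ℝ = fromℚ 0ℚ
  1ℝ = fromℚ 1ℚ

  fromNat : ℕ → ℝ
  fromNat n = fromℚ (+ n ℚ./ 1)

  pointwise : ∀ {x y} → (∀ n → seq x n ≡ seq y n) → x ≈ y
  pointwise {x} {y} eq = mk≈ λ ε 0<ε → 0 , λ n _ → begin
    ℚ.∣ seq x n ℚ.- seq y n ∣   ≡⟨ cong (λ q → ℚ.∣ seq x n ℚ.- q ∣) (≡.sym (eq n)) ⟩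
    ℚ.∣ seq x n ℚ.- seq x n ∣   ≡⟨ cong ℚ.∣_∣ (ℚₚ.+-inverseʳ (seq x n)) ⟩
    0ℚ                          ≤⟨ ℚₚ.<⇒≤ 0<ε ⟩
    ε                           ∎

  eventually-≤ : ∀ {x y} N → (∀ n → N ℕ.≤ n → seq x n ℚ.≤ seq y n) → x ≤ y
  eventually-≤ {x} {y} N x≤y = mk≤ λ ε 0<ε → N , λ n N≤n → begin
    seq x n          ≤⟨ x≤y n N≤n ⟩
    seq y n          ≡⟨ ≡.sym (ℚₚ.+-identityʳ (seq y n)) ⟩
    seq y n ℚ.+ 0ℚ   ≤⟨ ℚₚ.+-monoʳ-≤ (seq y n) (ℚₚ.<⇒≤ 0<ε) ⟩
    seq y n ℚ.+ ε    ∎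

  pointwise-≤ : ∀ {x y} → (∀ n → seq x n ℚ.≤ seq y n) → x ≤ y
  pointwise-≤ x≤y = eventually-≤ 0 λ n _ → x≤y n

  shrink : ∀ {A} → 0ℚ ℚ.< A → ∀ ε → 0ℚ ℚ.< ε → ∃[ η ] (0ℚ ℚ.< η × A ℚ.* η ≡ ε)
  shrink {A} 0<A ε 0<ε =
    let D , 0<D , AD≡1 = inverse 0<A
    in D ℚ.* ε , 0<* 0<D 0<ε ,
       ≡.trans (≡.sym (ℚₚ.*-assoc A D ε)) (≡.trans (cong (ℚ._* ε) AD≡1) (ℚₚ.*-identityˡ ε))

  -- Allows an estimate to end in a fixed multiple of ε. The constant `A` is chosen before ε, so ε
  -- can be replaced by ε / `A`.
  close-upTo : ∀ {x y} A → 0ℚ ℚ.< A →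
    (∀ ε → 0ℚ ℚ.< ε → ∃[ N ] (∀ n → N ℕ.≤ n → ℚ.∣ seq x n ℚ.- seq y n ∣ ℚ.≤ A ℚ.* ε)) →
    x ≈ y
  close-upTo A 0<A h = mk≈ λ ε 0<ε →
    let η , 0<η , Aη≡ε = shrink 0<A ε 0<ε
        N , near       = h η 0<η
    in N , λ n N≤n → ℚₚ.≤-trans (near n N≤n) (ℚₚ.≤-reflexive Aη≡ε)

  below-upTo : ∀ {x y} A → 0ℚ ℚ.< A →
    (∀ ε → 0ℚ ℚ.< ε → ∃[ N ] (∀ n → N ℕ.≤ n → seq x n ℚ.≤ seq y n ℚ.+ A ℚ.* ε)) →
    x ≤ y
  below-upTo {x} {y} A 0<A h = mk≤ λ ε 0<ε →
    let η , 0<η , Aη≡ε = shrink 0<A ε 0<ε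
        N , near       = h η 0<η
    in N , λ n N≤n → subst (λ t → seq x n ℚ.≤ seq y n ℚ.+ t) Aη≡ε (near n N≤n)

  2ℚ : ℚ
  2ℚ = 1ℚ ℚ.+ 1ℚ

  0<2 : 0ℚ ℚ.< 2ℚ
  0<2 = ℚₚ.positive⁻¹ 2ℚ

  ε+ε : ∀ ε → ε ℚ.+ ε ≡ 2ℚ ℚ.* ε
  ε+ε = solve 1 (λ e → e :+ e := con 2ℚ :* e) ≡.refl

  ≈-refl : ∀ {x} → x ≈ x
  ≈-refl = pointwise λ _ → ≡.refl

  ≈-reflexive : ∀ {x y} → x ≡ y → x ≈ y
  ≈-reflexive ≡.refl = ≈-refl

  ≈-sym : ∀ {x y} → x ≈ y → y ≈ x
  ≈-sym {x} {y} x≈y = mk≈ λ ε 0<ε →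
    let N , near = close x≈y ε 0<ε
    in N , λ n N≤n → subst (ℚ._≤ ε) (∣∣-sub-comm (seq x n) (seq y n)) (near n N≤n)

  ≈-trans : ∀ {x y z} → x ≈ y → y ≈ z → x ≈ z
  ≈-trans {x} {y} {z} x≈y y≈z = close-upTo 2ℚ 0<2 λ ε 0<ε →
    let M , near₁ = close x≈y ε 0<ε
        N , near₂ = close y≈z ε 0<ε
    in M ℕ.⊔ N , λ n ≤n → begin
      ℚ.∣ seq x n ℚ.- seq z n ∣
        ≤⟨ ∣∣-triangle (seq x n) (seq y n) (seq z n) ⟩
      ℚ.∣ seq x n ℚ.- seq y n ∣ ℚ.+ ℚ.∣ seq y n ℚ.- seq z n ∣
        ≤⟨ ℚₚ.+-mono-≤ (near₁ n (⊔₁ {M} {N} ≤n)) (near₂ n (⊔₂ {M} {N} ≤n)) ⟩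
      ε ℚ.+ ε      ≡⟨ ε+ε ε ⟩
      2ℚ ℚ.* ε     ∎

  ≤-reflexive : ∀ {x y} → x ≈ y → x ≤ y
  ≤-reflexive {x} {y} x≈y = mk≤ λ ε 0<ε →
    let N , near = close x≈y ε 0<ε
    in N , λ n N≤n → begin
      seq x n
        ≡⟨ solve 2 (λ x y → x := y :+ (x :- y)) ≡.refl (seq x n) (seq y n) ⟩
      seq y n ℚ.+ (seq x n ℚ.- seq y n)
        ≤⟨ ℚₚ.+-monoʳ-≤ (seq y n) (ℚₚ.≤-trans (p≤∣p∣ _) (near n N≤n)) ⟩
      seq y n ℚ.+ ε ∎

  ≤-trans : ∀ {x y z} → x ≤ y → y ≤ z → x ≤ z
  ≤-trans {x} {y} {z} x≤y y≤z = below-upTo 2ℚ 0<2 λ ε 0<ε →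
    let M , x≤ = below x≤y ε 0<ε
        N , y≤ = below y≤z ε 0<ε
    in M ℕ.⊔ N , λ n ≤n → begin
      seq x n                     ≤⟨ x≤ n (⊔₁ {M} {N} ≤n) ⟩
      seq y n ℚ.+ ε               ≤⟨ ℚₚ.+-monoˡ-≤ ε (y≤ n (⊔₂ {M} {N} ≤n)) ⟩
      (seq z n ℚ.+ ε) ℚ.+ ε
        ≡⟨ solve 2 (λ z e → (z :+ e) :+ e := z :+ con 2ℚ :* e) ≡.refl (seq z n) ε ⟩
      seq z n ℚ.+ 2ℚ ℚ.* ε        ∎

  ≤-antisym : ∀ {x y} → x ≤ y → y ≤ x → x ≈ y
  ≤-antisym {x} {y} x≤y y≤x = mk≈ λ ε 0<ε →
    let M , x≤ = below x≤y ε 0<ε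
        N , y≤ = below y≤x ε 0<ε
    in M ℕ.⊔ N , λ n ≤n → ∣∣≤
      (sub-≤ (subst (seq x n ℚ.≤_) (ℚₚ.+-comm (seq y n) ε) (x≤ n (⊔₁ {M} {N} ≤n))))
      (subst (ℚ._≤ ε) (solve 2 (λ x y → y :- x := :- (x :- y)) ≡.refl (seq x n) (seq y n))
        (sub-≤ (subst (seq y n ℚ.≤_) (ℚₚ.+-comm (seq x n) ε) (y≤ n (⊔₂ {M} {N} ≤n)))))

  ≤-poset : Poset _ _ _
  ≤-poset = record
    { Carrier = ℝ
    ; _≈_ = _≈_
    ; _≤_ = _≤_
    ; isPartialOrder = record
      { isPreorder = record
        { isEquivalence = record { refl = ≈-refl ; sym = ≈-sym ; trans = ≈-trans }
        ; reflexive = ≤-reflexive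
        ; trans = ≤-trans
        }
      ; antisym = ≤-antisym
      }
    }

  ≤-refl : ∀ {x} → x ≤ x
  ≤-refl = ≤-reflexive ≈-refl

  opaque
    unfolding _+_

    +-cong : ∀ {x y u v} → x ≈ y → u ≈ v → x + u ≈ y + v
    +-cong {x} {y} {u} {v} x≈y u≈v = close-upTo 2ℚ 0<2 λ ε 0<ε →
      let M , near₁ = close x≈y ε 0<ε
          N , near₂ = close u≈v ε 0<ε
      in M ℕ.⊔ N , λ n ≤n → begin
        ℚ.∣ (seq x n ℚ.+ seq u n) ℚ.- (seq y n ℚ.+ seq v n) ∣
          ≡⟨ cong ℚ.∣_∣ (solve 4 (λ x y u v → (x :+ u) :- (y :+ v) := (x :- y) :+ (u :- v)) ≡.refl
               (seq x n) (seq y n) (seq u n) (seq v n)) ⟩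
        ℚ.∣ (seq x n ℚ.- seq y n) ℚ.+ (seq u n ℚ.- seq v n) ∣
          ≤⟨ ℚₚ.∣p+q∣≤∣p∣+∣q∣ (seq x n ℚ.- seq y n) (seq u n ℚ.- seq v n) ⟩
        ℚ.∣ seq x n ℚ.- seq y n ∣ ℚ.+ ℚ.∣ seq u n ℚ.- seq v n ∣
          ≤⟨ ℚₚ.+-mono-≤ (near₁ n (⊔₁ {M} {N} ≤n)) (near₂ n (⊔₂ {M} {N} ≤n)) ⟩
        ε ℚ.+ ε      ≡⟨ ε+ε ε ⟩
        2ℚ ℚ.* ε     ∎

    *-cong : ∀ {x y u v} → x ≈ y → u ≈ v → x * u ≈ y * v
    *-cong {x} {y} {u} {v} x≈y u≈v =
      let K , 0<K , P , x≤K = bounded (seq x) (cauchy x)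
          L , 0<L , Q , v≤L = bounded (seq v) (cauchy v)
      in close-upTo (K ℚ.+ L) (ℚₚ.+-mono-< 0<K 0<L) λ ε 0<ε →
      let M , near₁ = close x≈y ε 0<ε
          N , near₂ = close u≈v ε 0<ε
      in (P ℕ.⊔ Q) ℕ.⊔ (M ℕ.⊔ N) , λ n ≤n →
      let PQ≤n = ⊔₁ {P ℕ.⊔ Q} {M ℕ.⊔ N} ≤n
          MN≤n = ⊔₂ {P ℕ.⊔ Q} {M ℕ.⊔ N} ≤n
      in begin
        ℚ.∣ seq x n ℚ.* seq u n ℚ.- seq y n ℚ.* seq v n ∣
          ≤⟨ ∣*-*∣≤ (seq x n) (seq u n) (seq y n) (seq v n) ⟩
        ℚ.∣ seq x n ∣ ℚ.* ℚ.∣ seq u n ℚ.- seq v n ∣ ℚ.+ ℚ.∣ seq v n ∣ ℚ.* ℚ.∣ seq x n ℚ.- seq y n ∣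
          ≤⟨ ℚₚ.+-mono-≤
               (*-mono (ℚₚ.0≤∣p∣ (seq u n ℚ.- seq v n)) (ℚₚ.<⇒≤ 0<K)
                 (x≤K n (⊔₁ {P} {Q} PQ≤n)) (near₂ n (⊔₂ {M} {N} MN≤n)))
               (*-mono (ℚₚ.0≤∣p∣ (seq x n ℚ.- seq y n)) (ℚₚ.<⇒≤ 0<L)
                 (v≤L n (⊔₂ {P} {Q} PQ≤n)) (near₁ n (⊔₁ {M} {N} MN≤n))) ⟩
        K ℚ.* ε ℚ.+ L ℚ.* ε   ≡⟨ ≡.sym (ℚₚ.*-distribʳ-+ ε K L) ⟩
        (K ℚ.+ L) ℚ.* ε       ∎

    ∣∣-cong : ∀ {x y} → x ≈ y → ∣ x ∣ ≈ ∣ y ∣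
    ∣∣-cong {x} {y} x≈y = mk≈ λ ε 0<ε →
      let N , near = close x≈y ε 0<ε
      in N , λ n N≤n → ℚₚ.≤-trans (reverse-triangle (seq x n) (seq y n)) (near n N≤n)

    -‿cong : ∀ {x y} → x ≈ y → - x ≈ - y
    -‿cong {x} {y} x≈y = mk≈ λ ε 0<ε →
      let N , near = close x≈y ε 0<ε
      in N , λ n N≤n → subst (ℚ._≤ ε)
        (≡.trans (∣∣-sub-comm (seq x n) (seq y n)) (cong ℚ.∣_∣
          (solve 2 (λ x y → y :- x := (:- x) :- (:- y)) ≡.refl (seq x n) (seq y n))))
        (near n N≤n)

    +-mono-≤ : ∀ {x y u v} → x ≤ y → u ≤ v → x + u ≤ y + v
    +-mono-≤ {x} {y} {u} {v} x≤y u≤v = below-upTo 2ℚ 0<2 λ ε 0<ε →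
      let M , x≤ = below x≤y ε 0<ε
          N , u≤ = below u≤v ε 0<ε
      in M ℕ.⊔ N , λ n ≤n → begin
        seq x n ℚ.+ seq u n
          ≤⟨ ℚₚ.+-mono-≤ (x≤ n (⊔₁ {M} {N} ≤n)) (u≤ n (⊔₂ {M} {N} ≤n)) ⟩
        (seq y n ℚ.+ ε) ℚ.+ (seq v n ℚ.+ ε)
          ≡⟨ solve 3 (λ y v e → (y :+ e) :+ (v :+ e) := (y :+ v) :+ con 2ℚ :* e) ≡.refl
               (seq y n) (seq v n) ε ⟩
        (seq y n ℚ.+ seq v n) ℚ.+ 2ℚ ℚ.* ε ∎

    ∣∣-least : ∀ {x y} → x ≤ y → - x ≤ y → ∣ x ∣ ≤ y
    ∣∣-least {x} {y} x≤y -x≤y = mk≤ λ ε 0<ε →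
      let M , x≤  = below x≤y ε 0<ε
          N , -x≤ = below -x≤y ε 0<ε
      in M ℕ.⊔ N , λ n ≤n → ∣∣≤ (x≤ n (⊔₁ {M} {N} ≤n)) (-x≤ n (⊔₂ {M} {N} ≤n))

    ≤-fromAbove : ∀ {x y} → (∀ ε → 0ℚ ℚ.< ε → x ≤ y + fromℚ ε) → x ≤ y
    ≤-fromAbove {x} {y} h = below-upTo 2ℚ 0<2 λ ε 0<ε →
      let N , x≤ = below (h ε 0<ε) ε 0<ε
      in N , λ n N≤n → ℚₚ.≤-trans (x≤ n N≤n) (ℚₚ.≤-reflexive
        (solve 2 (λ y e → (y :+ e) :+ e := y :+ con 2ℚ :* e) ≡.refl (seq y n) ε))

    +-assoc : ∀ x y z → (x + y) + z ≈ x + (y + z)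
    +-assoc x y z = pointwise λ n → ℚₚ.+-assoc (seq x n) (seq y n) (seq z n)

    +-comm : ∀ x y → x + y ≈ y + x
    +-comm x y = pointwise λ n → ℚₚ.+-comm (seq x n) (seq y n)

    +-identityˡ : ∀ x → 0ℝ + x ≈ x
    +-identityˡ x = pointwise λ n → ℚₚ.+-identityˡ (seq x n)

    +-inverseˡ : ∀ x → - x + x ≈ 0ℝ
    +-inverseˡ x = pointwise λ n → ℚₚ.+-inverseˡ (seq x n)

    *-assoc : ∀ x y z → (x * y) * z ≈ x * (y * z)
    *-assoc x y z = pointwise λ n → ℚₚ.*-assoc (seq x n) (seq y n) (seq z n)

    *-comm : ∀ x y → x * y ≈ y * x
    *-comm x y = pointwise λ n → ℚₚ.*-comm (seq x n) (seq y n)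

    *-identityˡ : ∀ x → 1ℝ * x ≈ x
    *-identityˡ x = pointwise λ n → ℚₚ.*-identityˡ (seq x n)

    *-distribʳ-+ : ∀ x y z → (y + z) * x ≈ y * x + z * x
    *-distribʳ-+ x y z = pointwise λ n → ℚₚ.*-distribʳ-+ (seq x n) (seq y n) (seq z n)

    fromℚ-+ : ∀ p q → fromℚ (p ℚ.+ q) ≈ fromℚ p + fromℚ q
    fromℚ-+ p q = pointwise λ _ → ≡.refl

    fromℚ-* : ∀ p q → fromℚ (p ℚ.* q) ≈ fromℚ p * fromℚ q
    fromℚ-* p q = pointwise λ _ → ≡.refl

    fromℚ-neg : ∀ p → fromℚ (ℚ.- p) ≈ - fromℚ p
    fromℚ-neg p = pointwise λ _ → ≡.refl

    fromℚ-mono : ∀ {p q} → p ℚ.≤ q → fromℚ p ≤ fromℚ q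
    fromℚ-mono p≤q = pointwise-≤ λ _ → p≤q

    x≤∣x∣ : ∀ {x} → x ≤ ∣ x ∣
    x≤∣x∣ {x} = pointwise-≤ λ n → p≤∣p∣ (seq x n)

    0≤∣x∣ : ∀ {x} → 0ℝ ≤ ∣ x ∣
    0≤∣x∣ {x} = pointwise-≤ λ n → ℚₚ.0≤∣p∣ (seq x n)

    ∣x+y∣≤∣x∣+∣y∣ : ∀ x y → ∣ x + y ∣ ≤ ∣ x ∣ + ∣ y ∣
    ∣x+y∣≤∣x∣+∣y∣ x y = pointwise-≤ λ n → ℚₚ.∣p+q∣≤∣p∣+∣q∣ (seq x n) (seq y n)

    ∣x*y∣≈∣x∣*∣y∣ : ∀ x y → ∣ x * y ∣ ≈ ∣ x ∣ * ∣ y ∣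
    ∣x*y∣≈∣x∣*∣y∣ x y = pointwise λ n → ℚₚ.∣p*q∣≡∣p∣*∣q∣ (seq x n) (seq y n)

    ∣-x∣≈∣x∣ : ∀ x → ∣ - x ∣ ≈ ∣ x ∣
    ∣-x∣≈∣x∣ x = pointwise λ n → ℚₚ.∣-p∣≡∣p∣ (seq x n)

    -- Only a tail of the sequence is bounded by `K`, which suffices because `_≤_` looks at tails.
    -- Replacing a real constant by such a positive rational is what makes it divisible out by
    -- `shrink`.
    ceiling : ∀ x → ∃[ K ] (0ℚ ℚ.< K × ∣ x ∣ ≤ fromℚ K)
    ceiling x =
      let K , 0<K , N , x≤K = bounded (seq x) (cauchy x)
      in K , 0<K , eventually-≤ N x≤K

  -- Parametrised by the operations so that sums and powers can also be formed over the abstract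
  -- operations in `unfold-operations`.
  rawRing : (ℚ → ℝ) → (ℝ → ℝ → ℝ) → (ℝ → ℝ → ℝ) → (ℝ → ℝ) → RawRing 0ℓ 0ℓ
  rawRing fromℚ _+_ _*_ (-_) = record
    { Carrier = ℝ ; _≈_ = _≈_ ; _+_ = _+_ ; _*_ = _*_ ; -_ = -_
    ; 0# = fromℚ 0ℚ ; 1# = fromℚ 1ℚ }

  ℝ-rawRing : RawRing 0ℓ 0ℓ
  ℝ-rawRing = rawRing fromℚ _+_ _*_ (-_)

  open RawSemiringDefs (RawRing.rawSemiring ℝ-rawRing) public using (_^_; sum)

  -- A bound on a real bounds its approximations only up to an error, taken here to be 1. This is
  -- why the rational estimates below are applied with `K = B + 1`.
  eventually-∣∣≤ : ∀ {x B} → Defs.∣ x ∣ ≤ Defs.fromℚ B →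
    ∃[ N ] (∀ n → N ℕ.≤ n → ℚ.∣ seq x n ∣ ℚ.≤ B ℚ.+ 1ℚ)
  eventually-∣∣≤ x≤B = below x≤B 1ℚ (ℚₚ.positive⁻¹ 1ℚ)

  -- Bounds, Lipschitz and Taylor estimates for the real exponential

  module _ {B : ℚ} (0<B : 0ℚ ℚ.< B) where

    open ExponentialSeries
    open Defs using (expTerm; expPartial)

    private
      K : ℚ
      K = B ℚ.+ 1ℚ

      0<K : 0ℚ ℚ.< K
      0<K = ℚₚ.+-mono-< 0<B (ℚₚ.positive⁻¹ 1ℚ)

      l : ℕ
      l = proj₁ (halving 0<K)

      half : ∀ j → l ℕ.≤ j → K ℚ.* Defs.recip (suc j) ℚ.≤ ½
      half = proj₂ (halving 0<K)

    -- From index `l` on the terms at `K` at least halve, so everything after index `l` adds at most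
    -- the term of index `l`. As the exponential is its own derivative, this one constant serves as
    -- bound, Lipschitz constant and Taylor constant.
    expBound : ℚ
    expBound = expTerm K l ℚ.+ expPartial l K

    opaque
      unfolding _+_

      ∣exp∣≤ : ∀ {x} → ∣ x ∣ ≤ fromℚ B → ∣ exp x ∣ ≤ fromℚ expBound
      ∣exp∣≤ x≤B =
        let M , x≤K = eventually-∣∣≤ x≤B
        in eventually-≤ (M ℕ.⊔ l) λ n ≤n → ℚₚ.≤-trans
             (∣expPartial∣≤ 0<K (x≤K n (⊔₁ {M} {l} ≤n)) n)
             (expPartial-bound 0<K half n (⊔₂ {M} {l} ≤n))

      exp-lipschitz : ∀ {x y} → ∣ x ∣ ≤ fromℚ B → ∣ y ∣ ≤ fromℚ B →
        ∣ exp y - exp x ∣ ≤ fromℚ expBound * ∣ y - x ∣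
      exp-lipschitz {x} {y} x≤B y≤B =
        let M , x≤K = eventually-∣∣≤ x≤B
            N , y≤K = eventually-∣∣≤ y≤B
        in eventually-≤ ((M ℕ.⊔ N) ℕ.⊔ l) λ n ≤n →
        let MN≤n = ⊔₁ {M ℕ.⊔ N} {l} ≤n
            h    = ℚ.∣ seq y n ℚ.- seq x n ∣
        in begin
          ℚ.∣ expPartial n (seq y n) ℚ.- expPartial n (seq x n) ∣
            ≤⟨ expPartial-lipschitz 0<K (y≤K n (⊔₂ {M} {N} MN≤n)) (x≤K n (⊔₁ {M} {N} MN≤n)) n ⟩
          h ℚ.* expPartial n K
            ≤⟨ *-mono (0≤expPartial (ℚₚ.<⇒≤ 0<K) n) (ℚₚ.0≤∣p∣ (seq y n ℚ.- seq x n)) ℚₚ.≤-refl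
                 (expPartial-bound 0<K half n (⊔₂ {M ℕ.⊔ N} {l} ≤n)) ⟩
          h ℚ.* expBound
            ≡⟨ ℚₚ.*-comm h expBound ⟩
          expBound ℚ.* h ∎

      -- The rational estimate leaves an additive error from the top term. It tends to 0 by
      -- `expTerm-null`, so the ε in the definition of `_≤_` absorbs it.
      exp-taylor : ∀ {x y} → ∣ x ∣ ≤ fromℚ B → ∣ y ∣ ≤ fromℚ B →
        ∣ exp y - exp x - exp x * (y - x) ∣ ≤ fromℚ expBound * (∣ y - x ∣ * ∣ y - x ∣)
      exp-taylor {x} {y} x≤B y≤B = below-upTo A 0<A λ ε 0<ε →
        let M , x≤K  = eventually-∣∣≤ x≤B
            N , y≤K  = eventually-∣∣≤ y≤B
            T , tiny = expTerm-null 0<K half ε 0<ε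
        -- The threshold is a successor because `expPartial-taylor` at `n` speaks of partial sums of
        -- index `suc n`.
        in suc ((M ℕ.⊔ N) ℕ.⊔ (l ℕ.⊔ T)) , λ where
          (suc n) (ℕ.s≤s ≤n) →
            let MN≤n = ⊔₁ {M ℕ.⊔ N} {l ℕ.⊔ T} ≤n
                lT≤n = ⊔₂ {M ℕ.⊔ N} {l ℕ.⊔ T} ≤n
                xₙ = seq x (suc n)
                yₙ = seq y (suc n)
                H  = ℚ.∣ yₙ ℚ.- xₙ ∣ ℚ.* ℚ.∣ yₙ ℚ.- xₙ ∣
            in begin
              ℚ.∣ expPartial (suc n) yₙ ℚ.- expPartial (suc n) xₙ
                  ℚ.- expPartial (suc n) xₙ ℚ.* (yₙ ℚ.- xₙ) ∣
                ≤⟨ expPartial-taylor 0<K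
                     (x≤K (suc n) (ℕₚ.m≤n⇒m≤1+n (⊔₁ {M} {N} MN≤n)))
                     (y≤K (suc n) (ℕₚ.m≤n⇒m≤1+n (⊔₂ {M} {N} MN≤n))) n ⟩
              expPartial n K ℚ.* H ℚ.+ expTerm K (suc n) ℚ.* (K ℚ.+ K)
                ≤⟨ ℚₚ.+-mono-≤
                     (*-mono (0≤* (ℚₚ.0≤∣p∣ (yₙ ℚ.- xₙ)) (ℚₚ.0≤∣p∣ (yₙ ℚ.- xₙ)))
                       0≤expBound (expPartial-bound 0<K half n (⊔₁ {l} {T} lT≤n)) ℚₚ.≤-refl)
                     (*-mono 0≤2K (0≤* 0≤k (ℚₚ.<⇒≤ 0<ε))
                       (tiny (suc n) (ℕₚ.m≤n⇒m≤1+n (⊔₂ {l} {T} lT≤n))) ℚₚ.≤-refl) ⟩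
              expBound ℚ.* H ℚ.+ (k ℚ.* ε) ℚ.* (K ℚ.+ K)
                ≤⟨ ℚₚ.+-monoʳ-≤ (expBound ℚ.* H) (begin
                     (k ℚ.* ε) ℚ.* (K ℚ.+ K)
                       ≡⟨ solve 3 (λ k e K → (k :* e) :* (K :+ K) := con 0ℚ :+ (k :* (K :+ K)) :* e)
                            ≡.refl k ε K ⟩
                     0ℚ ℚ.+ (k ℚ.* (K ℚ.+ K)) ℚ.* ε
                       ≤⟨ ℚₚ.+-monoˡ-≤ ((k ℚ.* (K ℚ.+ K)) ℚ.* ε) (ℚₚ.<⇒≤ 0<ε) ⟩
                     ε ℚ.+ (k ℚ.* (K ℚ.+ K)) ℚ.* ε
                       ≡⟨ solve 2 (λ e t → e :+ t :* e := (con 1ℚ :+ t) :* e)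
                            ≡.refl ε (k ℚ.* (K ℚ.+ K)) ⟩
                     A ℚ.* ε ∎) ⟩
              expBound ℚ.* H ℚ.+ A ℚ.* ε ∎
        where
        0≤2K : 0ℚ ℚ.≤ K ℚ.+ K
        0≤2K = 0≤+ (0≤K 0<K) (0≤K 0<K)
        k A : ℚ
        k = expTerm K l ℚ.* K
        -- The top term is at most `k * ε` and the increment at most `K + K`; the summand 1 makes
        -- the constant strictly positive.
        A = 1ℚ ℚ.+ k ℚ.* (K ℚ.+ K)
        0≤k : 0ℚ ℚ.≤ k
        0≤k = 0≤* (0≤expTerm (0≤K 0<K) l) (0≤K 0<K)
        0<A : 0ℚ ℚ.< A
        0<A = ℚₚ.+-mono-<-≤ (ℚₚ.positive⁻¹ 1ℚ) (0≤* 0≤k 0≤2K)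
        0≤expBound : 0ℚ ℚ.≤ expBound
        0≤expBound = 0≤+ (0≤expTerm (0≤K 0<K) l) (0≤expPartial (0≤K 0<K) l)

  opaque
    unfolding _+_

    exp-zero : exp 0ℝ ≈ 1ℝ
    exp-zero = pointwise go
      where
      go : ∀ n → Defs.expPartial n 0ℚ ≡ 1ℚ
      go zero = ≡.refl
      go (suc n) = ≡.trans (expPartial-suc n 0ℚ) (cong₂ ℚ._+_ (go n)
        (≡.trans (cong (ℚ._* r) (ℚₚ.*-zeroˡ (0ℚ Defs.ℚSemiring.^ n))) (ℚₚ.*-zeroˡ r)))
        where
        r : ℚ
        r = Defs.recip (suc n !) {{suc n ℕₚ.!≢0}}

    seq-^ : ∀ x k n → seq (x ^ k) n ≡ seq x n Defs.ℚSemiring.^ k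
    seq-^ x zero n = ≡.refl
    seq-^ x (suc k) n = cong (seq x n ℚ.*_) (seq-^ x k n)

    -- One term of a series with nonnegative terms is kept. The diagonal sequence contains that term
    -- from position `k` on.
    ^≤exp : ∀ x k → ∣ x ∣ ^ k * fromℚ (Defs.recip (k !) {{k ℕₚ.!≢0}}) ≤ exp ∣ x ∣
    ^≤exp x k = eventually-≤ k λ n k≤n →
      let q = ℚ.∣ seq x n ∣
      in begin
      seq (∣ x ∣ ^ k) n ℚ.* Defs.recip (k !) {{k ℕₚ.!≢0}}
        ≡⟨ cong (ℚ._* Defs.recip (k !) {{k ℕₚ.!≢0}}) (seq-^ ∣ x ∣ k n) ⟩
      Defs.expTerm q k
        ≤⟨ ExponentialSeries.expTerm≤expPartial (ℚₚ.0≤∣p∣ (seq x n)) k (n ℕ.∸ k) ⟩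
      Defs.expPartial (n ℕ.∸ k ℕ.+ k) q
        ≡⟨ cong (λ m → Defs.expPartial m q) (ℕₚ.m∸n+n≡m k≤n) ⟩
      Defs.expPartial n q ∎

  -- Passage from the opaque operations to the original ones

  opaque
    unfolding _+_

    private
      unfold-primitives :
        (P : (ℚ → ℝ) → (ℝ → ℝ → ℝ) → (ℝ → ℝ → ℝ) → (ℝ → ℝ) → (ℝ → ℝ) → (ℝ → ℝ) → Set) →
        P fromℚ _+_ _*_ (-_) ∣_∣ exp →
        P Defs.fromℚ Defs._+_ Defs._*_ Defs.-_ Defs.∣_∣ Defs.exp
      unfold-primitives P p = p

  module _
    (P : (ℚ → ℝ) → (ℕ → ℝ) → (ℝ → ℝ → ℝ) → (ℝ → ℝ → ℝ) → (ℝ → ℝ) → (ℝ → ℝ) → (ℝ → ℝ) →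
         (∀ {n} → (Fin n → ℝ) → ℝ) → (ℝ → ℕ → ℝ) → Set)
    where

    private
      P′ : (ℚ → ℝ) → (ℝ → ℝ → ℝ) → (ℝ → ℝ → ℝ) → (ℝ → ℝ) → (ℝ → ℝ) → (ℝ → ℝ) → Set
      P′ fromℚ _+_ _*_ -_ ∣_∣ exp =
        P fromℚ (λ n → fromℚ (+ n ℚ./ 1)) (λ x y → x + (- y)) _*_ (-_) ∣_∣ exp
          (RawSemiringDefs.sum (RawRing.rawSemiring (rawRing fromℚ _+_ _*_ (-_))))
          (RawSemiringDefs._^_ (RawRing.rawSemiring (rawRing fromℚ _+_ _*_ (-_))))

    -- Unfolding the opaque operations inside a term makes Agda compare the Cauchy proofs of
    -- its subterms; abstracting the operations first makes the comparison immediate.  The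
    -- sum and power are written as they occur in unfolded definitions of Defs, since
    -- Defs.sum and Defs._^_ are copies that are not syntactically equal to these.
    unfold-operations :
      P fromℚ fromNat _-_ _*_ (-_) ∣_∣ exp sum _^_ →
      P Defs.fromℚ Defs.fromNat Defs._-_ Defs._*_ Defs.-_ Defs.∣_∣ Defs.exp
        (RawSemiringDefs.sum (RawRing.rawSemiring Defs.ℝ-rawRing))
        (RawSemiringDefs._^_ (RawRing.rawSemiring Defs.ℝ-rawRing))
    unfold-operations = unfold-primitives P′

  width≡ : ∀ {a b} (P : Defs.TaggedPartition a b) i →
    Defs.width P i ≡ Defs.point P (Fin.suc i) - Defs.point P (inject₁ i)
  width≡ P i = ≡.sym (unfold-operations
    (λ _ _ _-′_ _ _ _ _ _ _ →
      Defs.point P (Fin.suc i) - Defs.point P (inject₁ i)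
        ≡ Defs.point P (Fin.suc i) -′ Defs.point P (inject₁ i))
    ≡.refl)

  riemannSum≡sum : ∀ f {a b} (P : Defs.TaggedPartition a b) →
    Defs.riemannSum f P ≡ sum (λ i → f (Defs.tag P i) * Defs.width P i)
  riemannSum≡sum f P = ≡.sym (unfold-operations
    (λ _ _ _ _*′_ _ _ _ sum′ _ → sum (λ i → f (Defs.tag P i) * Defs.width P i)
      ≡ sum′ (λ i → f (Defs.tag P i) *′ Defs.width P i))
    ≡.refl)

  fromℚ≡ : ∀ q → fromℚ q ≡ Defs.fromℚ q
  fromℚ≡ q = unfold-operations (λ fromℚ′ _ _ _ _ _ _ _ _ → fromℚ q ≡ fromℚ′ q) ≡.refl

  unfold-distance : ∀ x y ε → ∣ x - y ∣ ≤ fromℚ ε → Defs.∣ x Defs.- y ∣ ≤ Defs.fromℚ ε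
  unfold-distance x y ε = unfold-operations
    (λ fromℚ′ _ _-′_ _ _ ∣_∣′ _ _ _ → ∣ x - y ∣ ≤ fromℚ ε → ∣ x -′ y ∣′ ≤ fromℚ′ ε)
    λ d≤ε → d≤ε

module Calculus where

  open Defs using (ℝ; _≈_; _≤_)
  open RealOrder
  open PartialOrderReasoning ≤-poset

  -- Ring solver and inequalities over the reals

  ℝ-commutativeRing : CommutativeRing 0ℓ 0ℓ
  ℝ-commutativeRing = record
    { Carrier = ℝ ; _≈_ = _≈_ ; _+_ = _+_ ; _*_ = _*_ ; -_ = -_ ; 0# = 0ℝ ; 1# = 1ℝ
    ; isCommutativeRing = record
      { isRing = record
        { +-isAbelianGroup = record
          { isGroup = record
            { isMonoid = record
              { isSemigroup = record
                { isMagma = record { isEquivalence = Poset.isEquivalence ≤-poset ; ∙-cong = +-cong }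
                ; assoc = +-assoc
                }
              ; identity = comm∧idˡ⇒id +-comm +-identityˡ
              }
            ; inverse = comm∧invˡ⇒inv +-comm +-inverseˡ
            ; ⁻¹-cong = -‿cong
            }
          ; comm = +-comm
          }
        ; *-cong = *-cong
        ; *-assoc = *-assoc
        ; *-identity = comm∧idˡ⇒id *-comm *-identityˡ
        ; distrib = comm∧distrʳ⇒distr +-cong *-comm *-distribʳ-+
        }
      ; *-comm = *-comm
      }
    }
    where open Consequences (Poset.Eq.setoid ≤-poset)

  ℚ-coefficients : ℚₚ.+-*-rawRing -Raw-AlmostCommutative⟶ fromCommutativeRing ℝ-commutativeRing
  ℚ-coefficients = record
    { ⟦_⟧ = fromℚ ; +-homo = fromℚ-+ ; *-homo = fromℚ-* ; -‿homo = fromℚ-neg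
    ; 0-homo = ≈-refl ; 1-homo = ≈-refl }

  open SemiringSum (CommutativeRing.semiring ℝ-commutativeRing)
    using (sum-cong-≋; *-distribˡ-sum; *-distribʳ-sum)
  open RingSolver ℚₚ.+-*-rawRing (fromCommutativeRing ℝ-commutativeRing) ℚ-coefficients
    (λ p q → Maybe.map (λ p≡q → ≤-antisym
        (fromℚ-mono (ℚₚ.≤-reflexive p≡q)) (fromℚ-mono (ℚₚ.≤-reflexive (≡.sym p≡q))))
      (dec⇒maybe (p ℚₚ.≟ q)))
    using (solve; _:+_; _:*_; _:-_; :-_; _:=_; con)

  ≤⇒0≤- : ∀ {x y} → x ≤ y → 0ℝ ≤ y - x
  ≤⇒0≤- {x} {y} x≤y = begin
    0ℝ      ≈⟨ solve 1 (λ x → con 0ℚ := x :- x) ≈-refl x ⟩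
    x - x   ≤⟨ +-mono-≤ x≤y ≤-refl ⟩
    y - x   ∎

  0≤-⇒≤ : ∀ {x y} → 0ℝ ≤ y - x → x ≤ y
  0≤-⇒≤ {x} {y} 0≤y-x = begin
    x             ≈⟨ solve 1 (λ x → x := con 0ℚ :+ x) ≈-refl x ⟩
    0ℝ + x        ≤⟨ +-mono-≤ 0≤y-x ≤-refl ⟩
    (y - x) + x   ≈⟨ solve 2 (λ x y → (y :- x) :+ x := y) ≈-refl x y ⟩
    y             ∎

  sub-mono-≤ : ∀ {x y u v} → x ≤ y → v ≤ u → x - u ≤ y - v
  sub-mono-≤ {x} {y} {u} {v} x≤y v≤u = 0≤-⇒≤ (begin
    0ℝ                      ≈⟨ solve 0 (con 0ℚ := con 0ℚ :+ con 0ℚ) ≈-refl ⟩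
    0ℝ + 0ℝ                 ≤⟨ +-mono-≤ (≤⇒0≤- x≤y) (≤⇒0≤- v≤u) ⟩
    (y - x) + (u - v)
      ≈⟨ solve 4 (λ x y u v → (y :- x) :+ (u :- v) := (y :- v) :- (x :- u)) ≈-refl x y u v ⟩
    (y - v) - (x - u)       ∎)

  0≤x⇒∣x∣≈x : ∀ {x} → 0ℝ ≤ x → ∣ x ∣ ≈ x
  0≤x⇒∣x∣≈x {x} 0≤x = ≤-antisym (∣∣-least ≤-refl -x≤x) x≤∣x∣
    where
    -x≤x : - x ≤ x
    -x≤x = 0≤-⇒≤ (begin
      0ℝ          ≈⟨ solve 0 (con 0ℚ := con 0ℚ :+ con 0ℚ) ≈-refl ⟩
      0ℝ + 0ℝ     ≤⟨ +-mono-≤ 0≤x 0≤x ⟩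
      x + x       ≈⟨ solve 1 (λ x → x :+ x := x :- (:- x)) ≈-refl x ⟩
      x - (- x)   ∎)

  -- Multiplicativity of the absolute value stands in for an ε-argument: the product of two
  -- nonnegative reals equals its own absolute value.
  0≤x*y : ∀ {x y} → 0ℝ ≤ x → 0ℝ ≤ y → 0ℝ ≤ x * y
  0≤x*y {x} {y} 0≤x 0≤y = begin
    0ℝ              ≤⟨ 0≤∣x∣ ⟩
    ∣ x * y ∣       ≈⟨ ∣x*y∣≈∣x∣*∣y∣ x y ⟩
    ∣ x ∣ * ∣ y ∣   ≈⟨ *-cong (0≤x⇒∣x∣≈x 0≤x) (0≤x⇒∣x∣≈x 0≤y) ⟩
    x * y           ∎

  *-mono-≤ : ∀ {x y u v} → 0ℝ ≤ u → 0ℝ ≤ y → x ≤ y → u ≤ v → x * u ≤ y * v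
  *-mono-≤ {x} {y} {u} {v} 0≤u 0≤y x≤y u≤v = 0≤-⇒≤ (begin
    0ℝ                          ≈⟨ solve 0 (con 0ℚ := con 0ℚ :+ con 0ℚ) ≈-refl ⟩
    0ℝ + 0ℝ
      ≤⟨ +-mono-≤ (0≤x*y 0≤y (≤⇒0≤- u≤v)) (0≤x*y (≤⇒0≤- x≤y) 0≤u) ⟩
    y * (v - u) + (y - x) * u
      ≈⟨ solve 4 (λ x y u v → y :* (v :- u) :+ (y :- x) :* u := y :* v :- x :* u) ≈-refl x y u v ⟩
    y * v - x * u               ∎)

  ∣*∣-mono : ∀ {x y u v} → ∣ x ∣ ≤ y → ∣ u ∣ ≤ v → ∣ x * u ∣ ≤ y * v
  ∣*∣-mono {x} {y} {u} {v} x≤y u≤v = begin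
    ∣ x * u ∣       ≈⟨ ∣x*y∣≈∣x∣*∣y∣ x u ⟩
    ∣ x ∣ * ∣ u ∣   ≤⟨ *-mono-≤ 0≤∣x∣ (≤-trans 0≤∣x∣ x≤y) x≤y u≤v ⟩
    y * v           ∎

  ∣+∣-mono : ∀ {x y u v} → ∣ x ∣ ≤ y → ∣ u ∣ ≤ v → ∣ x + u ∣ ≤ y + v
  ∣+∣-mono {x} {y} {u} x≤y u≤v = ≤-trans (∣x+y∣≤∣x∣+∣y∣ x u) (+-mono-≤ x≤y u≤v)

  ∣x-y∣≈∣y-x∣ : ∀ x y → ∣ x - y ∣ ≈ ∣ y - x ∣
  ∣x-y∣≈∣y-x∣ x y = ≈-trans
    (∣∣-cong (solve 2 (λ x y → x :- y := :- (y :- x)) ≈-refl x y)) (∣-x∣≈∣x∣ (y - x))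

  ∣0∣≤0 : ∣ 0ℝ ∣ ≤ 0ℝ
  ∣0∣≤0 = ≤-reflexive (0≤x⇒∣x∣≈x ≤-refl)

  ∣x-y∣≤0⇒x≤y : ∀ {x y} → ∣ x - y ∣ ≤ 0ℝ → x ≤ y
  ∣x-y∣≤0⇒x≤y {x} {y} d≤0 = begin
    x             ≈⟨ solve 2 (λ x y → x := (x :- y) :+ y) ≈-refl x y ⟩
    (x - y) + y   ≤⟨ +-mono-≤ (≤-trans x≤∣x∣ d≤0) ≤-refl ⟩
    0ℝ + y        ≈⟨ solve 1 (λ y → con 0ℚ :+ y := y) ≈-refl y ⟩
    y             ∎

  ∣x-y∣≤0⇒x≈y : ∀ {x y} → ∣ x - y ∣ ≤ 0ℝ → x ≈ y
  ∣x-y∣≤0⇒x≈y {x} {y} d≤0 = ≤-antisym (∣x-y∣≤0⇒x≤y d≤0)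
    (∣x-y∣≤0⇒x≤y (≤-trans (≤-reflexive (∣x-y∣≈∣y-x∣ y x)) d≤0))

  fromNat-suc : ∀ n → fromNat (suc n) ≈ 1ℝ + fromNat n
  fromNat-suc n = ≈-trans (≈-reflexive (cong fromℚ (fromℕ-suc n))) (fromℚ-+ 1ℚ (+ n ℚ./ 1))

  fromNat-* : ∀ m n → fromNat (m ℕ.* n) ≈ fromNat m * fromNat n
  fromNat-* m n = ≈-trans (≈-reflexive (cong fromℚ (ExponentialSeries.fromℕ-* m n)))
    (fromℚ-* (+ m ℚ./ 1) (+ n ℚ./ 1))

  -- Uniform differentiation

  -- Uniform differentiability on [-B, B], with f the derivative of G; the first two bounds
  -- are what makes the notion closed under products.
  record Derivative (B : ℚ) (G f : ℝ → ℝ) : Set where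
    field
      M L C     : ℝ
      bound     : ∀ {x} → ∣ x ∣ ≤ fromℚ B → ∣ G x ∣ ≤ M
      lipschitz : ∀ {x y} → ∣ x ∣ ≤ fromℚ B → ∣ y ∣ ≤ fromℚ B → ∣ G y - G x ∣ ≤ L * ∣ y - x ∣
      taylor    : ∀ {x y} → ∣ x ∣ ≤ fromℚ B → ∣ y ∣ ≤ fromℚ B →
        ∣ G y - G x - f x * (y - x) ∣ ≤ C * (∣ y - x ∣ * ∣ y - x ∣)

  open Derivative

  module _ {B : ℚ} where

    derivative-cong : ∀ {G G′ f f′} → (∀ t → G t ≈ G′ t) → (∀ t → f t ≈ f′ t) →
      Derivative B G f → Derivative B G′ f′
    derivative-cong {G} {G′} {f} {f′} G≈ f≈ D = record
      { M = M D ; L = L D ; C = C D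
      ; bound = λ {x} x≤B → begin
          ∣ G′ x ∣            ≈⟨ ∣∣-cong (≈-sym (G≈ x)) ⟩
          ∣ G x ∣             ≤⟨ bound D x≤B ⟩
          M D                 ∎
      ; lipschitz = λ {x} {y} x≤B y≤B → begin
          ∣ G′ y - G′ x ∣     ≈⟨ ∣∣-cong (≈-sym (+-cong (G≈ y) (-‿cong (G≈ x)))) ⟩
          ∣ G y - G x ∣       ≤⟨ lipschitz D x≤B y≤B ⟩
          L D * ∣ y - x ∣     ∎
      ; taylor = λ {x} {y} x≤B y≤B → begin
          ∣ G′ y - G′ x - f′ x * (y - x) ∣
            ≈⟨ ∣∣-cong (≈-sym (+-cong (+-cong (G≈ y) (-‿cong (G≈ x)))
                 (-‿cong (*-cong (f≈ x) ≈-refl)))) ⟩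
          ∣ G y - G x - f x * (y - x) ∣
            ≤⟨ taylor D x≤B y≤B ⟩
          C D * (∣ y - x ∣ * ∣ y - x ∣) ∎
      }

    const-derivative : ∀ c → Derivative B (λ _ → c) (λ _ → 0ℝ)
    const-derivative c = record
      { M = ∣ c ∣ ; L = 0ℝ ; C = 0ℝ
      ; bound = λ _ → ≤-refl
      ; lipschitz = λ {x} {y} _ _ → begin
          ∣ c - c ∣          ≈⟨ ∣∣-cong (solve 1 (λ c → c :- c := con 0ℚ) ≈-refl c) ⟩
          ∣ 0ℝ ∣             ≤⟨ ∣0∣≤0 ⟩
          0ℝ                 ≈⟨ solve 1 (λ h → con 0ℚ := con 0ℚ :* h) ≈-refl ∣ y - x ∣ ⟩
          0ℝ * ∣ y - x ∣     ∎
      ; taylor = λ {x} {y} _ _ → begin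
          ∣ c - c - 0ℝ * (y - x) ∣
            ≈⟨ ∣∣-cong (solve 2 (λ c h → c :- c :- con 0ℚ :* h := con 0ℚ) ≈-refl c (y - x)) ⟩
          ∣ 0ℝ ∣             ≤⟨ ∣0∣≤0 ⟩
          0ℝ                 ≈⟨ solve 1 (λ h → con 0ℚ := con 0ℚ :* (h :* h)) ≈-refl ∣ y - x ∣ ⟩
          0ℝ * (∣ y - x ∣ * ∣ y - x ∣) ∎
      }

    id-derivative : Derivative B (λ t → t) (λ _ → 1ℝ)
    id-derivative = record
      { M = fromℚ B ; L = 1ℝ ; C = 0ℝ
      ; bound = λ x≤B → x≤B
      ; lipschitz = λ {x} {y} _ _ →
          ≤-reflexive (solve 1 (λ h → h := con 1ℚ :* h) ≈-refl ∣ y - x ∣)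
      ; taylor = λ {x} {y} _ _ → begin
          ∣ y - x - 1ℝ * (y - x) ∣
            ≈⟨ ∣∣-cong (solve 2 (λ x y → y :- x :- con 1ℚ :* (y :- x) := con 0ℚ) ≈-refl x y) ⟩
          ∣ 0ℝ ∣             ≤⟨ ∣0∣≤0 ⟩
          0ℝ                 ≈⟨ solve 1 (λ h → con 0ℚ := con 0ℚ :* (h :* h)) ≈-refl ∣ y - x ∣ ⟩
          0ℝ * (∣ y - x ∣ * ∣ y - x ∣) ∎
      }

    +-derivative : ∀ {G₁ G₂ f₁ f₂} → Derivative B G₁ f₁ → Derivative B G₂ f₂ →
      Derivative B (λ t → G₁ t + G₂ t) (λ t → f₁ t + f₂ t)
    +-derivative {G₁} {G₂} {f₁} {f₂} D₁ D₂ = record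
      { M = M D₁ + M D₂ ; L = L D₁ + L D₂ ; C = C D₁ + C D₂
      ; bound = λ x≤B → ∣+∣-mono (bound D₁ x≤B) (bound D₂ x≤B)
      ; lipschitz = λ {x} {y} x≤B y≤B → begin
          ∣ (G₁ y + G₂ y) - (G₁ x + G₂ x) ∣
            ≈⟨ ∣∣-cong (solve 4 (λ a b c d → (a :+ b) :- (c :+ d) := (a :- c) :+ (b :- d)) ≈-refl
                 (G₁ y) (G₂ y) (G₁ x) (G₂ x)) ⟩
          ∣ (G₁ y - G₁ x) + (G₂ y - G₂ x) ∣
            ≤⟨ ∣+∣-mono (lipschitz D₁ x≤B y≤B) (lipschitz D₂ x≤B y≤B) ⟩
          L D₁ * ∣ y - x ∣ + L D₂ * ∣ y - x ∣
            ≈⟨ ≈-sym (*-distribʳ-+ ∣ y - x ∣ (L D₁) (L D₂)) ⟩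
          (L D₁ + L D₂) * ∣ y - x ∣ ∎
      ; taylor = λ {x} {y} x≤B y≤B → begin
          ∣ (G₁ y + G₂ y) - (G₁ x + G₂ x) - (f₁ x + f₂ x) * (y - x) ∣
            ≈⟨ ∣∣-cong (solve 7 (λ a b c d f g h →
                 (a :+ b) :- (c :+ d) :- (f :+ g) :* h := (a :- c :- f :* h) :+ (b :- d :- g :* h))
                 ≈-refl (G₁ y) (G₂ y) (G₁ x) (G₂ x) (f₁ x) (f₂ x) (y - x)) ⟩
          ∣ (G₁ y - G₁ x - f₁ x * (y - x)) + (G₂ y - G₂ x - f₂ x * (y - x)) ∣
            ≤⟨ ∣+∣-mono (taylor D₁ x≤B y≤B) (taylor D₂ x≤B y≤B) ⟩
          C D₁ * (∣ y - x ∣ * ∣ y - x ∣) + C D₂ * (∣ y - x ∣ * ∣ y - x ∣)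
            ≈⟨ ≈-sym (*-distribʳ-+ (∣ y - x ∣ * ∣ y - x ∣) (C D₁) (C D₂)) ⟩
          (C D₁ + C D₂) * (∣ y - x ∣ * ∣ y - x ∣) ∎
      }

    *-derivative : ∀ {G₁ G₂ f₁ f₂} → Derivative B G₁ f₁ → Derivative B G₂ f₂ →
      Derivative B (λ t → G₁ t * G₂ t) (λ t → f₁ t * G₂ t + G₁ t * f₂ t)
    *-derivative {G₁} {G₂} {f₁} {f₂} D₁ D₂ = record
      { M = M D₁ * M D₂
      ; L = L D₁ * M D₂ + M D₁ * L D₂
      ; C = C D₁ * M D₂ + M D₁ * C D₂ + L D₁ * L D₂
      ; bound = λ x≤B → ∣*∣-mono (bound D₁ x≤B) (bound D₂ x≤B)
      ; lipschitz = λ {x} {y} x≤B y≤B → begin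
          ∣ G₁ y * G₂ y - G₁ x * G₂ x ∣
            ≈⟨ ∣∣-cong (solve 4 (λ a b c d → a :* b :- c :* d := (a :- c) :* b :+ c :* (b :- d))
                 ≈-refl (G₁ y) (G₂ y) (G₁ x) (G₂ x)) ⟩
          ∣ (G₁ y - G₁ x) * G₂ y + G₁ x * (G₂ y - G₂ x) ∣
            ≤⟨ ∣+∣-mono (∣*∣-mono (lipschitz D₁ x≤B y≤B) (bound D₂ y≤B))
                        (∣*∣-mono (bound D₁ x≤B) (lipschitz D₂ x≤B y≤B)) ⟩
          (L D₁ * ∣ y - x ∣) * M D₂ + M D₁ * (L D₂ * ∣ y - x ∣)
            ≈⟨ solve 5 (λ l₁ m₂ m₁ l₂ h →
                 (l₁ :* h) :* m₂ :+ m₁ :* (l₂ :* h) := (l₁ :* m₂ :+ m₁ :* l₂) :* h)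
                 ≈-refl (L D₁) (M D₂) (M D₁) (L D₂) ∣ y - x ∣ ⟩
          (L D₁ * M D₂ + M D₁ * L D₂) * ∣ y - x ∣ ∎
      ; taylor = λ {x} {y} x≤B y≤B → begin
          ∣ G₁ y * G₂ y - G₁ x * G₂ x - (f₁ x * G₂ x + G₁ x * f₂ x) * (y - x) ∣
            -- Besides the two remainders, the product of the increments of both factors is left
            -- over. The Lipschitz bounds make it quadratic, whence the summand `L D₁ * L D₂` of the
            -- constant.
            ≈⟨ ∣∣-cong (solve 7 (λ a b c d f g h →
                 a :* b :- c :* d :- (f :* d :+ c :* g) :* h
                 := ((a :- c :- f :* h) :* d :+ c :* (b :- d :- g :* h)) :+ (a :- c) :* (b :- d))
                 ≈-refl (G₁ y) (G₂ y) (G₁ x) (G₂ x) (f₁ x) (f₂ x) (y - x)) ⟩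
          ∣ ((G₁ y - G₁ x - f₁ x * (y - x)) * G₂ x + G₁ x * (G₂ y - G₂ x - f₂ x * (y - x)))
            + (G₁ y - G₁ x) * (G₂ y - G₂ x) ∣
            ≤⟨ ∣+∣-mono
                 (∣+∣-mono (∣*∣-mono (taylor D₁ x≤B y≤B) (bound D₂ x≤B))
                           (∣*∣-mono (bound D₁ x≤B) (taylor D₂ x≤B y≤B)))
                 (∣*∣-mono (lipschitz D₁ x≤B y≤B) (lipschitz D₂ x≤B y≤B)) ⟩
          ((C D₁ * (∣ y - x ∣ * ∣ y - x ∣)) * M D₂ + M D₁ * (C D₂ * (∣ y - x ∣ * ∣ y - x ∣)))
            + (L D₁ * ∣ y - x ∣) * (L D₂ * ∣ y - x ∣)
            ≈⟨ solve 7 (λ c₁ m₂ m₁ c₂ l₁ l₂ h →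
                 ((c₁ :* (h :* h)) :* m₂ :+ m₁ :* (c₂ :* (h :* h))) :+ (l₁ :* h) :* (l₂ :* h)
                 := (c₁ :* m₂ :+ m₁ :* c₂ :+ l₁ :* l₂) :* (h :* h))
                 ≈-refl (C D₁) (M D₂) (M D₁) (C D₂) (L D₁) (L D₂) ∣ y - x ∣ ⟩
          (C D₁ * M D₂ + M D₁ * C D₂ + L D₁ * L D₂) * (∣ y - x ∣ * ∣ y - x ∣) ∎
      }

    scale-derivative : ∀ c {G f} → Derivative B G f → Derivative B (λ t → c * G t) (λ t → c * f t)
    scale-derivative c {G} {f} D = derivative-cong
      (λ _ → ≈-refl)
      (λ t → solve 3 (λ c g f → con 0ℚ :* g :+ c :* f := c :* f) ≈-refl c (G t) (f t))
      (*-derivative (const-derivative c) D)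

    sum-derivative : ∀ {n} (c : Fin n → ℝ) {G f : Fin n → ℝ → ℝ} →
      (∀ i → Derivative B (G i) (f i)) →
      Derivative B (λ t → sum (λ i → c i * G i t)) (λ t → sum (λ i → c i * f i t))
    sum-derivative {zero} c D = const-derivative 0ℝ
    sum-derivative {suc n} c D = +-derivative
      (scale-derivative (c Fin.zero) (D Fin.zero))
      (sum-derivative (λ i → c (Fin.suc i)) (λ i → D (Fin.suc i)))

    ^-derivative : ∀ k → Derivative B (_^ suc k) (λ t → fromNat (suc k) * t ^ k)
    ^-derivative zero = derivative-cong
      (λ t → solve 1 (λ t → t := t :* con 1ℚ) ≈-refl t)
      (λ _ → solve 0 (con 1ℚ := con 1ℚ :* con 1ℚ) ≈-refl)
      id-derivative
    ^-derivative (suc k) = derivative-cong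
      (λ _ → ≈-refl)
      (λ t → ≈-trans
        (solve 3 (λ t n p → con 1ℚ :* (t :* p) :+ t :* (n :* p) := (con 1ℚ :+ n) :* (t :* p))
          ≈-refl t (fromNat (suc k)) (t ^ k))
        (*-cong (≈-sym (fromNat-suc (suc k))) ≈-refl))
      (*-derivative id-derivative (^-derivative k))

    module _ (0<B : 0ℚ ℚ.< B) where

      exp-derivative : Derivative B exp exp
      exp-derivative = record
        { bound = ∣exp∣≤ 0<B ; lipschitz = exp-lipschitz 0<B ; taylor = exp-taylor 0<B }

      -- Reflection preserves the interval and all distances, so the estimates for `exp` at `- x`
      -- and `- y` apply with the same constants and take the place of a chain rule.
      exp-neg-derivative : Derivative B (λ t → exp (- t)) (λ t → - exp (- t))
      exp-neg-derivative = record
        { bound = λ x≤B → ∣exp∣≤ 0<B (neg x≤B)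
        ; lipschitz = λ {x} {y} x≤B y≤B → begin
            ∣ exp (- y) - exp (- x) ∣
              ≤⟨ exp-lipschitz 0<B (neg x≤B) (neg y≤B) ⟩
            S * ∣ - y - - x ∣
              ≈⟨ *-cong ≈-refl (neg-sub x y) ⟩
            S * ∣ y - x ∣ ∎
        ; taylor = λ {x} {y} x≤B y≤B → begin
            ∣ exp (- y) - exp (- x) - (- exp (- x)) * (y - x) ∣
              ≈⟨ ∣∣-cong (solve 4 (λ a b x y → a :- b :- (:- b) :* (y :- x)
                   := a :- b :- b :* ((:- y) :- (:- x))) ≈-refl (exp (- y)) (exp (- x)) x y) ⟩
            ∣ exp (- y) - exp (- x) - exp (- x) * (- y - - x) ∣
              ≤⟨ exp-taylor 0<B (neg x≤B) (neg y≤B) ⟩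
            S * (∣ - y - - x ∣ * ∣ - y - - x ∣)
              ≈⟨ *-cong ≈-refl (*-cong (neg-sub x y) (neg-sub x y)) ⟩
            S * (∣ y - x ∣ * ∣ y - x ∣) ∎
        }
        where
        S : ℝ
        S = fromℚ (expBound 0<B)
        neg : ∀ {x} → ∣ x ∣ ≤ fromℚ B → ∣ - x ∣ ≤ fromℚ B
        neg {x} x≤B = ≤-trans (≤-reflexive (∣-x∣≈∣x∣ x)) x≤B
        neg-sub : ∀ x y → ∣ - y - - x ∣ ≈ ∣ y - x ∣
        neg-sub x y = ≈-trans
          (∣∣-cong (solve 2 (λ x y → (:- y) :- (:- x) := x :- y) ≈-refl x y)) (∣x-y∣≈∣y-x∣ x y)

  -- The Lipschitz bound forces `G` to identify equal reals. This is wanted for `exp` and for the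
  -- ends of a partition, which match 0 and `b` only up to `_≈_`.
  derivative⇒cong : ∀ {B G f} → Derivative B G f → ∀ {x y} →
    ∣ x ∣ ≤ fromℚ B → ∣ y ∣ ≤ fromℚ B → x ≈ y → G x ≈ G y
  derivative⇒cong {B} {G} D {x} {y} x≤B y≤B x≈y = ≈-sym (∣x-y∣≤0⇒x≈y (begin
    ∣ G y - G x ∣       ≤⟨ lipschitz D x≤B y≤B ⟩
    L D * ∣ y - x ∣     ≈⟨ *-cong ≈-refl (∣∣-cong (+-cong (≈-sym x≈y) ≈-refl)) ⟩
    L D * ∣ x - x ∣     ≈⟨ *-cong ≈-refl (∣∣-cong (solve 1 (λ x → x :- x := con 0ℚ) ≈-refl x)) ⟩
    L D * ∣ 0ℝ ∣        ≈⟨ *-cong ≈-refl (0≤x⇒∣x∣≈x ≤-refl) ⟩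
    L D * 0ℝ            ≈⟨ solve 1 (λ l → l :* con 0ℚ := con 0ℚ) ≈-refl (L D) ⟩
    0ℝ                  ∎))

  exp-cong : ∀ {x y} → x ≈ y → exp x ≈ exp y
  exp-cong {x} {y} x≈y =
    let B , 0<B , x≤B = ceiling x
    in derivative⇒cong (exp-derivative 0<B) x≤B
         (≤-trans (≤-reflexive (∣∣-cong (≈-sym x≈y))) x≤B) x≈y

  0≤ℚ : ∀ {q} → 0ℚ ℚ.< q → 0ℝ ≤ fromℚ q
  0≤ℚ 0<q = fromℚ-mono (ℚₚ.<⇒≤ 0<q)

  ½ℝ : ℝ
  ½ℝ = fromℚ ½

  -- Functions with zero derivative

  -- Bisection: a function with zero derivative changes by O(w²) over an interval of length w,
  -- and halving the interval halves the total of these bounds.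
  module _ {B : ℚ} {G : ℝ → ℝ} (D : Derivative B G (λ _ → 0ℝ)) where

    variation≤ : ∀ n {x y} → ∣ x ∣ ≤ fromℚ B → ∣ y ∣ ≤ fromℚ B →
      ∣ G y - G x ∣ ≤ fromℚ (½ Defs.ℚSemiring.^ n) * (C D * (∣ y - x ∣ * ∣ y - x ∣))
    variation≤ zero {x} {y} x≤B y≤B = begin
      ∣ G y - G x ∣
        ≈⟨ ∣∣-cong (solve 3 (λ a b h → a :- b := a :- b :- con 0ℚ :* h) ≈-refl (G y) (G x) (y - x)) ⟩
      ∣ G y - G x - 0ℝ * (y - x) ∣
        ≤⟨ taylor D x≤B y≤B ⟩
      C D * (∣ y - x ∣ * ∣ y - x ∣)
        ≈⟨ ≈-sym (*-identityˡ _) ⟩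
      1ℝ * (C D * (∣ y - x ∣ * ∣ y - x ∣)) ∎
    variation≤ (suc n) {x} {y} x≤B y≤B = begin
      ∣ G y - G x ∣
        ≈⟨ ∣∣-cong (solve 3 (λ a b c → a :- b := (a :- c) :+ (c :- b)) ≈-refl (G y) (G x) (G z)) ⟩
      ∣ (G y - G z) + (G z - G x) ∣
        ≤⟨ ∣+∣-mono (variation≤ n z≤B y≤B) (variation≤ n x≤B z≤B) ⟩
      p * (C D * (∣ y - z ∣ * ∣ y - z ∣)) + p * (C D * (∣ z - x ∣ * ∣ z - x ∣))
        ≈⟨ +-cong (*-cong ≈-refl (*-cong ≈-refl (*-cong y-z y-z)))
                  (*-cong ≈-refl (*-cong ≈-refl (*-cong z-x z-x))) ⟩
      p * (C D * ((½ℝ * h) * (½ℝ * h))) + p * (C D * ((½ℝ * h) * (½ℝ * h)))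
        ≈⟨ solve 3 (λ p c h →
             p :* (c :* ((con ½ :* h) :* (con ½ :* h))) :+ p :* (c :* ((con ½ :* h) :* (con ½ :* h)))
             := (con ½ :* p) :* (c :* (h :* h))) ≈-refl p (C D) h ⟩
      (½ℝ * p) * (C D * (h * h))
        ≈⟨ *-cong (≈-sym (fromℚ-* ½ (½ Defs.ℚSemiring.^ n))) ≈-refl ⟩
      fromℚ (½ Defs.ℚSemiring.^ suc n) * (C D * (h * h)) ∎
      where
      z p h : ℝ
      z = ½ℝ * x + ½ℝ * y
      p = fromℚ (½ Defs.ℚSemiring.^ n)
      h = ∣ y - x ∣
      ∣½∣≤½ : ∣ ½ℝ ∣ ≤ ½ℝ
      ∣½∣≤½ = ≤-reflexive (0≤x⇒∣x∣≈x (0≤ℚ (ℚₚ.positive⁻¹ ½)))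
      z≤B : ∣ z ∣ ≤ fromℚ B
      z≤B = begin
        ∣ z ∣                          ≤⟨ ∣+∣-mono (∣*∣-mono ∣½∣≤½ x≤B) (∣*∣-mono ∣½∣≤½ y≤B) ⟩
        ½ℝ * fromℚ B + ½ℝ * fromℚ B
          ≈⟨ solve 1 (λ b → con ½ :* b :+ con ½ :* b := b) ≈-refl (fromℚ B) ⟩
        fromℚ B                        ∎
      half : ∣ ½ℝ * (y - x) ∣ ≈ ½ℝ * h
      half = ≈-trans (∣x*y∣≈∣x∣*∣y∣ ½ℝ (y - x))
        (*-cong (0≤x⇒∣x∣≈x (0≤ℚ (ℚₚ.positive⁻¹ ½))) ≈-refl)
      y-z : ∣ y - z ∣ ≈ ½ℝ * h
      y-z = ≈-trans (∣∣-cong (solve 2 (λ x y →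
        y :- (con ½ :* x :+ con ½ :* y) := con ½ :* (y :- x)) ≈-refl x y)) half
      z-x : ∣ z - x ∣ ≈ ½ℝ * h
      z-x = ≈-trans (∣∣-cong (solve 2 (λ x y →
        (con ½ :* x :+ con ½ :* y) :- x := con ½ :* (y :- x)) ≈-refl x y)) half

    zero-derivative⇒constant : ∀ {x y} → ∣ x ∣ ≤ fromℚ B → ∣ y ∣ ≤ fromℚ B → G y ≈ G x
    zero-derivative⇒constant {x} {y} x≤B y≤B = ∣x-y∣≤0⇒x≈y (≤-fromAbove λ ε 0<ε →
      -- The number `n` of bisections is chosen so that `½ ^ n` is at most ε / `K`, where `K` is a
      -- rational bound for `A`.
      let K , 0<K , A≤K  = ceiling A
          η , 0<η , Kη≡ε = shrink 0<K ε 0<ε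
          n , small      = archimedean η 0<η
          p≤η            = ℚₚ.≤-trans (ExponentialSeries.½^≤recip n) (small n ℕₚ.≤-refl)
      in begin
        ∣ G y - G x ∣                        ≤⟨ variation≤ n x≤B y≤B ⟩
        fromℚ (½ Defs.ℚSemiring.^ n) * A
          ≤⟨ ≤-trans x≤∣x∣ (∣*∣-mono {_} {fromℚ η}
               (≤-trans (≤-reflexive (0≤x⇒∣x∣≈x (fromℚ-mono (ExponentialSeries.0≤½^ n))))
                 (fromℚ-mono p≤η))
               A≤K) ⟩
        fromℚ η * fromℚ K                    ≈⟨ *-comm (fromℚ η) (fromℚ K) ⟩
        fromℚ K * fromℚ η                    ≈⟨ ≈-sym (fromℚ-* K η) ⟩
        fromℚ (K ℚ.* η)                      ≈⟨ ≈-reflexive (cong fromℚ Kη≡ε) ⟩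
        fromℚ ε                              ≈⟨ ≈-sym (+-identityˡ (fromℚ ε)) ⟩
        0ℝ + fromℚ ε                         ∎)
      where
      A : ℝ
      A = C D * (∣ y - x ∣ * ∣ y - x ∣)

  -- Riemann sums of a derivative

  first≤last : ∀ n (p : Fin (suc n) → ℝ) → (∀ i → p (inject₁ i) ≤ p (Fin.suc i)) →
    p Fin.zero ≤ p (Fin.fromℕ n)
  first≤last zero p _ = ≤-refl
  first≤last (suc n) p mono = ≤-trans (mono Fin.zero)
    (first≤last n (λ i → p (Fin.suc i)) (λ i → mono (Fin.suc i)))

  ∣x∣≤-interval : ∀ {x b} → 0ℝ ≤ x → x ≤ b → ∣ x ∣ ≤ b
  ∣x∣≤-interval 0≤x x≤b = ≤-trans (≤-reflexive (0≤x⇒∣x∣≈x 0≤x)) x≤b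

  module _ {B : ℚ} {G f : ℝ → ℝ} (D : Derivative B G f) {δ : ℝ} where

    -- Expanding `G` about the tag `s` towards both ends makes the Riemann term the exact linear
    -- part. With `p = v - s` and `q = s - u` the remainders cost `p * p + q * q`, at most
    -- `δ * (p + q)`, which is linear in the width and so adds up over a partition. The record does
    -- not fix the sign of `C D`, hence the absolute value.
    step-error : ∀ {u s v} → 0ℝ ≤ u → u ≤ s → s ≤ v → v ≤ fromℚ B → v - u ≤ δ →
      ∣ f s * (v - u) - (G v - G u) ∣ ≤ (∣ C D ∣ * δ) * (v - u)
    step-error {u} {s} {v} 0≤u u≤s s≤v v≤B w≤δ = begin
      ∣ f s * (v - u) - (G v - G u) ∣
        ≈⟨ ∣∣-cong (solve 7 (λ f u s v gu gs gv →
             f :* (v :- u) :- (gv :- gu)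
             := (:- (gv :- gs :- f :* (v :- s))) :+ (gu :- gs :- f :* (u :- s)))
             ≈-refl (f s) u s v (G u) (G s) (G v)) ⟩
      ∣ - (G v - G s - f s * (v - s)) + (G u - G s - f s * (u - s)) ∣
        ≤⟨ ∣+∣-mono (≤-trans (≤-reflexive (∣-x∣≈∣x∣ _)) (taylor D s≤B v≤B′)) (taylor D s≤B u≤B) ⟩
      C D * (∣ v - s ∣ * ∣ v - s ∣) + C D * (∣ u - s ∣ * ∣ u - s ∣)
        ≈⟨ +-cong (*-cong ≈-refl (*-cong v-s v-s)) (*-cong ≈-refl (*-cong u-s u-s)) ⟩
      C D * (p * p) + C D * (q * q)
        ≈⟨ solve 3 (λ c p q → c :* p :+ c :* q := c :* (p :+ q)) ≈-refl (C D) (p * p) (q * q) ⟩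
      C D * (p * p + q * q)
        ≤⟨ *-mono-≤ (≤-trans (≤-reflexive 0≈0+0) (+-mono-≤ (0≤x*y 0≤p 0≤p) (0≤x*y 0≤q 0≤q)))
             0≤∣x∣ x≤∣x∣
             (+-mono-≤ (*-mono-≤ 0≤p (≤-trans 0≤p p≤δ) p≤δ ≤-refl)
                       (*-mono-≤ 0≤q (≤-trans 0≤q q≤δ) q≤δ ≤-refl)) ⟩
      ∣ C D ∣ * (δ * p + δ * q)
        ≈⟨ solve 5 (λ c d u s v → c :* (d :* (v :- s) :+ d :* (s :- u)) := (c :* d) :* (v :- u))
             ≈-refl ∣ C D ∣ δ u s v ⟩
      (∣ C D ∣ * δ) * (v - u) ∎
      where
      p q : ℝ
      p = v - s
      q = s - u
      0≤p : 0ℝ ≤ p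
      0≤p = ≤⇒0≤- s≤v
      0≤q : 0ℝ ≤ q
      0≤q = ≤⇒0≤- u≤s
      p≤δ : p ≤ δ
      p≤δ = ≤-trans (sub-mono-≤ ≤-refl u≤s) w≤δ
      q≤δ : q ≤ δ
      q≤δ = ≤-trans (sub-mono-≤ s≤v ≤-refl) w≤δ
      0≈0+0 : 0ℝ ≈ 0ℝ + 0ℝ
      0≈0+0 = solve 0 (con 0ℚ := con 0ℚ :+ con 0ℚ) ≈-refl
      v-s : ∣ v - s ∣ ≈ p
      v-s = 0≤x⇒∣x∣≈x 0≤p
      u-s : ∣ u - s ∣ ≈ q
      u-s = ≈-trans (∣x-y∣≈∣y-x∣ u s) (0≤x⇒∣x∣≈x 0≤q)
      0≤s : 0ℝ ≤ s
      0≤s = ≤-trans 0≤u u≤s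
      s≤B′ : s ≤ fromℚ B
      s≤B′ = ≤-trans s≤v v≤B
      u≤B : ∣ u ∣ ≤ fromℚ B
      u≤B = ∣x∣≤-interval 0≤u (≤-trans u≤s s≤B′)
      s≤B : ∣ s ∣ ≤ fromℚ B
      s≤B = ∣x∣≤-interval 0≤s s≤B′
      v≤B′ : ∣ v ∣ ≤ fromℚ B
      v≤B′ = ∣x∣≤-interval (≤-trans 0≤s s≤v) v≤B

    -- Stated for bare families of points and tags with a free left end, so that the first
    -- subinterval can be split off in the induction. The increments of `G` and the error bounds
    -- telescope together.
    riemannSum-error : ∀ n (p : Fin (suc n) → ℝ) (t : Fin n → ℝ) →
      (∀ i → p (inject₁ i) ≤ t i) → (∀ i → t i ≤ p (Fin.suc i)) →
      (∀ i → p (Fin.suc i) - p (inject₁ i) ≤ δ) →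
      0ℝ ≤ p Fin.zero → p (Fin.fromℕ n) ≤ fromℚ B →
      ∣ sum (λ i → f (t i) * (p (Fin.suc i) - p (inject₁ i)))
        - (G (p (Fin.fromℕ n)) - G (p Fin.zero)) ∣
        ≤ (∣ C D ∣ * δ) * (p (Fin.fromℕ n) - p Fin.zero)
    riemannSum-error zero p t p≤t t≤p w≤δ 0≤p₀ pₙ≤B = begin
      ∣ 0ℝ - (G (p Fin.zero) - G (p Fin.zero)) ∣
        ≈⟨ ∣∣-cong (solve 1 (λ g → con 0ℚ :- (g :- g) := con 0ℚ) ≈-refl (G (p Fin.zero))) ⟩
      ∣ 0ℝ ∣   ≤⟨ ∣0∣≤0 ⟩
      0ℝ
        ≈⟨ solve 2 (λ c p → con 0ℚ := c :* (p :- p)) ≈-refl (∣ C D ∣ * δ) (p Fin.zero) ⟩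
      (∣ C D ∣ * δ) * (p Fin.zero - p Fin.zero) ∎
    riemannSum-error (suc n) p t p≤t t≤p w≤δ 0≤p₀ pₙ≤B = begin
      ∣ (a + S) - (G pₙ - G p₀) ∣
        ≈⟨ ∣∣-cong (solve 5 (λ a S gₙ g₀ g₁ →
             (a :+ S) :- (gₙ :- g₀) := (a :- (g₁ :- g₀)) :+ (S :- (gₙ :- g₁)))
             ≈-refl a S (G pₙ) (G p₀) (G p₁)) ⟩
      ∣ (a - (G p₁ - G p₀)) + (S - (G pₙ - G p₁)) ∣
        ≤⟨ ∣+∣-mono
             (step-error 0≤p₀ (p≤t Fin.zero) (t≤p Fin.zero) (≤-trans p₁≤pₙ pₙ≤B) (w≤δ Fin.zero))
             (riemannSum-error n p′ (λ i → t (Fin.suc i)) (λ i → p≤t (Fin.suc i))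
               (λ i → t≤p (Fin.suc i)) (λ i → w≤δ (Fin.suc i)) (≤-trans 0≤p₀ p₀≤p₁) pₙ≤B) ⟩
      (∣ C D ∣ * δ) * (p₁ - p₀) + (∣ C D ∣ * δ) * (pₙ - p₁)
        ≈⟨ solve 4 (λ c p₀ p₁ pₙ → c :* (p₁ :- p₀) :+ c :* (pₙ :- p₁) := c :* (pₙ :- p₀))
             ≈-refl (∣ C D ∣ * δ) p₀ p₁ pₙ ⟩
      (∣ C D ∣ * δ) * (pₙ - p₀) ∎
      where
      p′ : Fin (suc n) → ℝ
      p′ i = p (Fin.suc i)
      p₀ p₁ pₙ a S : ℝ
      p₀ = p Fin.zero
      p₁ = p (Fin.suc Fin.zero)
      pₙ = p (Fin.fromℕ (suc n))
      a  = f (t Fin.zero) * (p₁ - p₀)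
      S  = sum (λ i → f (t (Fin.suc i)) * (p′ (Fin.suc i) - p′ (inject₁ i)))
      p₀≤p₁ : p₀ ≤ p₁
      p₀≤p₁ = ≤-trans (p≤t Fin.zero) (t≤p Fin.zero)
      p₁≤pₙ : p₁ ≤ pₙ
      p₁≤pₙ = first≤last n p′ (λ i → ≤-trans (p≤t (Fin.suc i)) (t≤p (Fin.suc i)))

  -- The widths form a family `w` of their own because those of a `TaggedPartition` are differences
  -- for the original subtraction, which `width≡` relates to the opaque one.
  riemannSum-converges : ∀ {G f} → (∀ {B} → 0ℚ ℚ.< B → Derivative B G f) → ∀ b →
    ∀ ε → 0ℚ ℚ.< ε → ∃[ δ ] (0ℚ ℚ.< δ ×
      (∀ n (p : Fin (suc n) → ℝ) (t w : Fin n → ℝ) →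
        (∀ i → w i ≡ p (Fin.suc i) - p (inject₁ i)) → p Fin.zero ≈ 0ℝ → p (Fin.fromℕ n) ≈ b →
        (∀ i → p (inject₁ i) ≤ t i) → (∀ i → t i ≤ p (Fin.suc i)) → (∀ i → w i ≤ fromℚ δ) →
        ∣ sum (λ i → f (t i) * w i) - (G b - G 0ℝ) ∣ ≤ fromℚ ε))
  riemannSum-converges {G} {f} deriv b ε 0<ε =
    let B , 0<B , ∣b∣≤B  = ceiling b
        D                = deriv 0<B
        K , 0<K , ∣C∣≤K  = ceiling (C D)
        -- The total error is at most `K * δ` times the length of the interval, and the length is at
        -- most `B`.
        δ , 0<δ , KBδ≡ε  = shrink (0<* 0<K 0<B) ε 0<ε
    in δ , 0<δ , λ n p t w w≡ p₀≈0 pₙ≈b p≤t t≤p w≤δ →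
    let p₀   = p Fin.zero
        pₙ   = p (Fin.fromℕ n)
        S    = sum (λ i → f (t i) * (p (Fin.suc i) - p (inject₁ i)))
        0≤B  = 0≤ℚ 0<B
        pₙ≤B = ≤-trans (≤-reflexive pₙ≈b) (≤-trans x≤∣x∣ ∣b∣≤B)
        0≤p₀ = ≤-reflexive (≈-sym p₀≈0)
        p₀≤pₙ = first≤last n p (λ i → ≤-trans (p≤t i) (t≤p i))
        Gpₙ≈ = derivative⇒cong D (∣x∣≤-interval (≤-trans 0≤p₀ p₀≤pₙ) pₙ≤B) ∣b∣≤B pₙ≈b
        Gp₀≈ = derivative⇒cong D (∣x∣≤-interval 0≤p₀ (≤-trans p₀≤pₙ pₙ≤B))
                 (∣x∣≤-interval ≤-refl 0≤B) p₀≈0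
    in begin
      ∣ sum (λ i → f (t i) * w i) - (G b - G 0ℝ) ∣
        ≈⟨ ∣∣-cong (+-cong
             (sum-cong-≋ {n} (λ i → *-cong (≈-refl {f (t i)}) (≈-reflexive (w≡ i)))) (-‿cong (≈-sym (+-cong Gpₙ≈ (-‿cong Gp₀≈))))) ⟩
      ∣ S - (G pₙ - G p₀) ∣
        ≤⟨ riemannSum-error D n p t p≤t t≤p
             (λ i → subst (_≤ fromℚ δ) (w≡ i) (w≤δ i)) 0≤p₀ pₙ≤B ⟩
      (∣ C D ∣ * fromℚ δ) * (pₙ - p₀)
        ≤⟨ *-mono-≤ (≤⇒0≤- p₀≤pₙ) (0≤x*y (0≤ℚ 0<K) (0≤ℚ 0<δ))
             (*-mono-≤ (0≤ℚ 0<δ) (0≤ℚ 0<K) ∣C∣≤K ≤-refl)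
             (sub-mono-≤ pₙ≤B 0≤p₀) ⟩
      (fromℚ K * fromℚ δ) * (fromℚ B - 0ℝ)
        ≈⟨ solve 3 (λ k d b → (k :* d) :* (b :- con 0ℚ) := (k :* b) :* d) ≈-refl
             (fromℚ K) (fromℚ δ) (fromℚ B) ⟩
      (fromℚ K * fromℚ B) * fromℚ δ
        ≈⟨ ≈-sym (≈-trans (fromℚ-* (K ℚ.* B) δ) (*-cong (fromℚ-* K B) ≈-refl)) ⟩
      fromℚ ((K ℚ.* B) ℚ.* δ)
        ≈⟨ ≈-reflexive (cong fromℚ KBδ≡ε) ⟩
      fromℚ ε ∎

  -- Decay of a power times the decreasing exponential

  exp-neg*exp : ∀ b → exp (- b) * exp b ≈ 1ℝ
  exp-neg*exp b =
    let B , 0<B , ∣b∣≤B = ceiling b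
    in ≈-trans
      (zero-derivative⇒constant
        (derivative-cong (λ _ → ≈-refl)
          (λ t → solve 2 (λ u v → (:- u) :* v :+ u :* v := con 0ℚ) ≈-refl (exp (- t)) (exp t))
          (*-derivative (exp-neg-derivative 0<B) (exp-derivative 0<B)))
        (∣x∣≤-interval ≤-refl (0≤ℚ 0<B)) ∣b∣≤B)
      (≈-trans
        (*-cong (≈-trans (exp-cong (solve 0 (:- con 0ℚ := con 0ℚ) ≈-refl)) exp-zero) exp-zero)
        (*-identityˡ 1ℝ))

  ∣x^k∣≈∣x∣^k : ∀ x k → ∣ x ^ k ∣ ≈ ∣ x ∣ ^ k
  ∣x^k∣≈∣x∣^k x zero = 0≤x⇒∣x∣≈x (0≤ℚ (ℚₚ.positive⁻¹ 1ℚ))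
  ∣x^k∣≈∣x∣^k x (suc k) = ≈-trans (∣x*y∣≈∣x∣*∣y∣ x (x ^ k)) (*-cong ≈-refl (∣x^k∣≈∣x∣^k x k))

  moment : ℕ → ℝ → ℝ
  moment k t = t ^ k * exp (- t)

  -- Decay of order 1 / `b`, with `b` kept as a factor so that no real is inverted. The exponential
  -- is compared with its term of index `suc k`, one above the power in the moment; the spare power
  -- is the factor `b`.
  moment-decay : ∀ k {b} → 0ℝ ≤ b → b * ∣ moment k b ∣ ≤ fromNat (suc k !)
  moment-decay k {b} 0≤b = begin
    b * ∣ b ^ k * e ∣
      ≈⟨ *-cong (≈-sym (0≤x⇒∣x∣≈x 0≤b)) (≈-trans (∣x*y∣≈∣x∣*∣y∣ (b ^ k) e)
           (*-cong (∣x^k∣≈∣x∣^k b k) ≈-refl)) ⟩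
    ∣ b ∣ * (∣ b ∣ ^ k * ∣ e ∣)
      ≈⟨ solve 3 (λ b p e → b :* (p :* e) := con 1ℚ :* ((b :* p) :* e)) ≈-refl
           (∣ b ∣) (∣ b ∣ ^ k) (∣ e ∣) ⟩
    1ℝ * (∣ b ∣ ^ suc k * ∣ e ∣)
      -- Inserting `r * N` puts the reciprocal factorial next to the power, which is the shape of
      -- `^≤exp`.
      ≈⟨ *-cong (≈-sym rN≈1) ≈-refl ⟩
    (r * N) * (∣ b ∣ ^ suc k * ∣ e ∣)
      ≈⟨ solve 4 (λ r n p e → (r :* n) :* (p :* e) := n :* ((p :* r) :* e)) ≈-refl
           r N (∣ b ∣ ^ suc k) (∣ e ∣) ⟩
    N * ((∣ b ∣ ^ suc k * r) * ∣ e ∣)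
      ≤⟨ *-mono-≤ (0≤x*y (0≤x*y 0≤p 0≤r) 0≤∣x∣) 0≤N ≤-refl (*-mono-≤ 0≤∣x∣ 0≤∣x∣ (begin
           ∣ b ∣ ^ suc k * r   ≤⟨ ^≤exp b (suc k) ⟩
           exp ∣ b ∣           ≈⟨ exp-cong (0≤x⇒∣x∣≈x 0≤b) ⟩
           exp b               ≤⟨ x≤∣x∣ ⟩
           ∣ exp b ∣           ∎) ≤-refl) ⟩
    N * (∣ exp b ∣ * ∣ e ∣)
      ≈⟨ *-cong ≈-refl (≈-sym (∣x*y∣≈∣x∣*∣y∣ (exp b) e)) ⟩
    N * ∣ exp b * e ∣
      ≈⟨ *-cong ≈-refl (∣∣-cong (≈-trans (*-comm (exp b) e) (exp-neg*exp b))) ⟩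
    N * ∣ 1ℝ ∣
      ≈⟨ *-cong ≈-refl (0≤x⇒∣x∣≈x (0≤ℚ (ℚₚ.positive⁻¹ 1ℚ))) ⟩
    N * 1ℝ
      ≈⟨ solve 1 (λ n → n :* con 1ℚ := n) ≈-refl N ⟩
    N ∎
    where
    instance
      suc-k!≢0 : NonZero (suc k !)
      suc-k!≢0 = suc k ℕₚ.!≢0
    e r N : ℝ
    e = exp (- b)
    r = fromℚ (Defs.recip (suc k !))
    N = fromNat (suc k !)
    rN≈1 : r * N ≈ 1ℝ
    rN≈1 = ≈-trans (≈-sym (fromℚ-* (Defs.recip (suc k !)) (+ (suc k !) ℚ./ 1)))
      (≈-reflexive (cong fromℚ (recip-inverse (suc k !))))
    0≤r : 0ℝ ≤ r
    0≤r = 0≤ℚ (0<recip (suc k !))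
    0≤N : 0ℝ ≤ N
    0≤N = fromℚ-mono (ExponentialSeries.0≤fromℕ (suc k !))
    0≤p : 0ℝ ≤ ∣ b ∣ ^ suc k
    0≤p = ≤-trans 0≤∣x∣ (≤-reflexive (∣x^k∣≈∣x∣^k b (suc k)))

  -- Limits at infinity

  Vanishes : (ℝ → ℝ) → Set
  Vanishes G = ∀ ε → 0ℚ ℚ.< ε →
    ∃[ B ] (∀ b → 0ℝ ≤ b → fromℚ B ≤ b → ∣ G b ∣ ≤ fromℚ ε)

  vanishes-cong : ∀ {G G′} → (∀ t → G t ≈ G′ t) → Vanishes G → Vanishes G′
  vanishes-cong G≈ V ε 0<ε =
    let B , small = V ε 0<ε
    in B , λ b 0≤b B≤b → ≤-trans (≤-reflexive (∣∣-cong (≈-sym (G≈ b)))) (small b 0≤b B≤b)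

  vanishes-+ : ∀ {G H} → Vanishes G → Vanishes H → Vanishes (λ t → G t + H t)
  vanishes-+ {G} {H} V W ε 0<ε =
    let A , small₁ = V (½ ℚ.* ε) 0<½ε
        B , small₂ = W (½ ℚ.* ε) 0<½ε
    in A ℚ.⊔ B , λ b 0≤b A⊔B≤b → begin
      ∣ G b + H b ∣
        ≤⟨ ∣+∣-mono (small₁ b 0≤b (≤-trans (fromℚ-mono (ℚₚ.p≤p⊔q A B)) A⊔B≤b))
                    (small₂ b 0≤b (≤-trans (fromℚ-mono (ℚₚ.p≤q⊔p A B)) A⊔B≤b)) ⟩
      fromℚ (½ ℚ.* ε) + fromℚ (½ ℚ.* ε)
        ≈⟨ +-cong (fromℚ-* ½ ε) (fromℚ-* ½ ε) ⟩
      ½ℝ * fromℚ ε + ½ℝ * fromℚ ε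
        ≈⟨ solve 1 (λ e → con ½ :* e :+ con ½ :* e := e) ≈-refl (fromℚ ε) ⟩
      fromℚ ε ∎
    where
    0<½ε : 0ℚ ℚ.< ½ ℚ.* ε
    0<½ε = 0<* (ℚₚ.positive⁻¹ ½) 0<ε

  vanishes-scale : ∀ c {G} → Vanishes G → Vanishes (λ t → c * G t)
  vanishes-scale c {G} V ε 0<ε =
    let K , 0<K , ∣c∣≤K = ceiling c
        η , 0<η , Kη≡ε  = shrink 0<K ε 0<ε
        B , small       = V η 0<η
    in B , λ b 0≤b B≤b → begin
      ∣ c * G b ∣           ≤⟨ ∣*∣-mono ∣c∣≤K (small b 0≤b B≤b) ⟩
      fromℚ K * fromℚ η     ≈⟨ ≈-sym (fromℚ-* K η) ⟩
      fromℚ (K ℚ.* η)       ≈⟨ ≈-reflexive (cong fromℚ Kη≡ε) ⟩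
      fromℚ ε               ∎

  vanishes-sum : ∀ {n} (c : Fin n → ℝ) {G : Fin n → ℝ → ℝ} → (∀ i → Vanishes (G i)) →
    Vanishes (λ t → sum (λ i → c i * G i t))
  vanishes-sum {zero} c V ε 0<ε = 0ℚ , λ _ _ _ → ≤-trans ∣0∣≤0 (0≤ℚ 0<ε)
  vanishes-sum {suc n} c V = vanishes-+ (vanishes-scale (c Fin.zero) (V Fin.zero))
    (vanishes-sum (λ i → c (Fin.suc i)) (λ i → V (Fin.suc i)))

  moment-vanishes : ∀ k → Vanishes (moment k)
  moment-vanishes k ε 0<ε =
    let A = + (suc k !) ℚ./ 1
        A⁻¹ , 0<A⁻¹ , AA⁻¹≡1 = inverse 0<A
        ε⁻¹ , 0<ε⁻¹ , εε⁻¹≡1 = inverse 0<ε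
        -- The threshold is `B = A / ε` and `q` is its inverse. The moment is multiplied by
        -- `q * B = 1`; then `B` may be enlarged to `b`, `moment-decay` gives the bound `A`, and
        -- `q * A` is ε.
        q = ε ℚ.* A⁻¹
        B = A ℚ.* ε⁻¹
        qA≡ε : q ℚ.* A ≡ ε
        qA≡ε = ≡.trans (ℚₚ.*-assoc ε A⁻¹ A) (≡.trans
          (cong (ε ℚ.*_) (≡.trans (ℚₚ.*-comm A⁻¹ A) AA⁻¹≡1)) (ℚₚ.*-identityʳ ε))
        qB≡1 : q ℚ.* B ≡ 1ℚ
        qB≡1 = ≡.trans (≡.sym (ℚₚ.*-assoc q A ε⁻¹)) (≡.trans (cong (ℚ._* ε⁻¹) qA≡ε) εε⁻¹≡1)
    in B , λ b 0≤b B≤b → begin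
      ∣ moment k b ∣
        ≈⟨ ≈-sym (*-identityˡ _) ⟩
      1ℝ * ∣ moment k b ∣
        ≈⟨ *-cong (≈-trans (≈-reflexive (cong fromℚ (≡.sym qB≡1))) (fromℚ-* q B)) ≈-refl ⟩
      (fromℚ q * fromℚ B) * ∣ moment k b ∣
        ≈⟨ *-assoc (fromℚ q) (fromℚ B) ∣ moment k b ∣ ⟩
      fromℚ q * (fromℚ B * ∣ moment k b ∣)
        ≤⟨ *-mono-≤ (0≤x*y (0≤ℚ (0<* 0<A 0<ε⁻¹)) 0≤∣x∣) (0≤ℚ (0<* 0<ε 0<A⁻¹)) ≤-refl
             (≤-trans (*-mono-≤ 0≤∣x∣ 0≤b B≤b ≤-refl) (moment-decay k 0≤b)) ⟩
      fromℚ q * fromℚ A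
        ≈⟨ ≈-sym (fromℚ-* q A) ⟩
      fromℚ (q ℚ.* A)
        ≈⟨ ≈-reflexive (cong fromℚ qA≡ε) ⟩
      fromℚ ε ∎
    where
    0<A : 0ℚ ℚ.< + (suc k !) ℚ./ 1
    0<A = ℚₚ.positive⁻¹ _ {{ℚₚ.normalize-pos (suc k !) 1 {{_}} {{suc k ℕₚ.!≢0}}}}

  -- The improper integral and the primitives of the moments

  isIntegral₀^∞ : ∀ {G f I} → (∀ {B} → 0ℚ ℚ.< B → Derivative B G f) →
    Vanishes (λ b → (G b - G 0ℝ) - I) → Defs.IsIntegral₀^∞ f I
  isIntegral₀^∞ {G} {f} {I} deriv vanishes =
    -- The integral over a bounded interval is the increment of the antiderivative, so convergence
    -- to `I` is precisely `vanishes`.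
    (λ b _ → G b - G 0ℝ) ,
    (λ b _ ε 0<ε →
      let δ , 0<δ , near = riemannSum-converges deriv b ε 0<ε
      in δ , 0<δ , λ P width≤δ → unfold-distance (Defs.riemannSum f P) (G b - G 0ℝ) ε (begin
        ∣ Defs.riemannSum f P - (G b - G 0ℝ) ∣
          ≡⟨ cong (λ S → ∣ S - (G b - G 0ℝ) ∣) (riemannSum≡sum f P) ⟩
        ∣ sum (λ i → f (tag P i) * width P i) - (G b - G 0ℝ) ∣
          ≤⟨ near (size P) (point P) (tag P) (width P) (width≡ P)
               (≈-trans (first P) (≈-reflexive (≡.sym (fromℚ≡ 0ℚ)))) (last P)
               (point≤tag P) (tag≤point P)
               (λ i → ≤-trans (width≤δ i) (≤-reflexive (≈-reflexive (≡.sym (fromℚ≡ δ))))) ⟩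
        fromℚ ε ∎)) ,
    (λ ε 0<ε →
      let B , small = vanishes ε 0<ε
      in fromℚ B , λ b 0≤b B≤b → unfold-distance (G b - G 0ℝ) I ε
           (small b (≤-trans (≤-reflexive (≈-reflexive (fromℚ≡ 0ℚ))) 0≤b) B≤b))
    where
    open Defs.TaggedPartition

  -- This is minus the upper incomplete gamma function Γ(k + 1, t); the recursion is integration by
  -- parts.
  gammaPrimitive : ℕ → ℝ → ℝ
  gammaPrimitive zero    t = - 1ℝ * moment zero t
  gammaPrimitive (suc k) t = - 1ℝ * moment (suc k) t + fromNat (suc k) * gammaPrimitive k t

  gammaPrimitive-derivative : ∀ k {B} → 0ℚ ℚ.< B → Derivative B (gammaPrimitive k) (moment k)
  gammaPrimitive-derivative zero 0<B = derivative-cong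
    (λ t → solve 1 (λ e → (:- con 1ℚ) :* e := (:- con 1ℚ) :* (con 1ℚ :* e)) ≈-refl (exp (- t)))
    (λ t → solve 1 (λ e → (:- con 1ℚ) :* (:- e) := con 1ℚ :* e) ≈-refl (exp (- t)))
    (scale-derivative (- 1ℝ) (exp-neg-derivative 0<B))
  gammaPrimitive-derivative (suc k) 0<B = derivative-cong
    (λ _ → ≈-refl)
    (λ t → solve 4 (λ n p q e →
      (:- con 1ℚ) :* ((n :* p) :* e :+ q :* (:- e)) :+ n :* (p :* e) := q :* e) ≈-refl
      (fromNat (suc k)) (t ^ k) (t ^ suc k) (exp (- t)))
    (+-derivative
      (scale-derivative (- 1ℝ) (*-derivative (^-derivative k) (exp-neg-derivative 0<B)))
      (scale-derivative (fromNat (suc k)) (gammaPrimitive-derivative k 0<B)))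

  gammaPrimitive-vanishes : ∀ k → Vanishes (gammaPrimitive k)
  gammaPrimitive-vanishes zero = vanishes-scale (- 1ℝ) (moment-vanishes zero)
  gammaPrimitive-vanishes (suc k) = vanishes-+
    (vanishes-scale (- 1ℝ) (moment-vanishes (suc k)))
    (vanishes-scale (fromNat (suc k)) (gammaPrimitive-vanishes k))

  gammaPrimitive-zero : ∀ k → gammaPrimitive k 0ℝ ≈ - fromNat (k !)
  gammaPrimitive-zero zero = ≈-trans
    (*-cong ≈-refl (*-cong ≈-refl
      (≈-trans (exp-cong (solve 0 (:- con 0ℚ := con 0ℚ) ≈-refl)) exp-zero)))
    (solve 0 ((:- con 1ℚ) :* (con 1ℚ :* con 1ℚ) := :- con 1ℚ) ≈-refl)
  gammaPrimitive-zero (suc k) = begin-equality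
    - 1ℝ * ((0ℝ * 0ℝ ^ k) * exp (- 0ℝ)) + fromNat (suc k) * gammaPrimitive k 0ℝ
      ≈⟨ +-cong ≈-refl (*-cong ≈-refl (gammaPrimitive-zero k)) ⟩
    - 1ℝ * ((0ℝ * 0ℝ ^ k) * exp (- 0ℝ)) + fromNat (suc k) * - fromNat (k !)
      ≈⟨ solve 4 (λ p e m n → (:- con 1ℚ) :* ((con 0ℚ :* p) :* e) :+ m :* (:- n) := :- (m :* n))
           ≈-refl (0ℝ ^ k) (exp (- 0ℝ)) (fromNat (suc k)) (fromNat (k !)) ⟩
    - (fromNat (suc k) * fromNat (k !))
      ≈⟨ -‿cong (≈-sym (fromNat-* (suc k) (k !))) ⟩
    - fromNat (suc k !) ∎

  ^-distrib-* : ∀ x y k → (x * y) ^ k ≈ x ^ k * y ^ k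
  ^-distrib-* x y zero = ≈-sym (*-identityˡ 1ℝ)
  ^-distrib-* x y (suc k) = ≈-trans (*-cong ≈-refl (^-distrib-* x y k))
    (solve 4 (λ x y p q → (x :* y) :* (p :* q) := (x :* p) :* (y :* q)) ≈-refl x y (x ^ k) (y ^ k))

  -- Polynomials against the exponential weight

  module _ (w : ℕ → ℝ) (n : ℕ) (x : ℝ) where

    integrand : ℝ → ℝ
    integrand t = sum {suc n} (λ k → w (toℕ k) * (x * t) ^ toℕ k) * exp (- t)

    -- The Laplace-Borel transform of the polynomial with coefficients `w`: the power of index `k`
    -- is weighted by the integral of its moment, which is `k !`.
    laplace : ℝ
    laplace = sum {suc n} (λ k → fromNat (toℕ k !) * w (toℕ k) * x ^ toℕ k)

    private
      coefficient : Fin (suc n) → ℝ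
      coefficient k = w (toℕ k) * x ^ toℕ k

    antiderivative : ℝ → ℝ
    antiderivative t = sum (λ k → coefficient k * gammaPrimitive (toℕ k) t)

    antiderivative-derivative : ∀ {B} → 0ℚ ℚ.< B → Derivative B antiderivative integrand
    antiderivative-derivative 0<B = derivative-cong
      (λ _ → ≈-refl)
      (λ t → ≈-trans
        (sum-cong-≋ {suc n} (λ k → ≈-trans
          (solve 4 (λ w p q e → (w :* p) :* (q :* e) := (w :* (p :* q)) :* e) ≈-refl
            (w (toℕ k)) (x ^ toℕ k) (t ^ toℕ k) (exp (- t)))
          (*-cong (*-cong ≈-refl (≈-sym (^-distrib-* x t (toℕ k)))) ≈-refl)))
        (≈-sym (*-distribʳ-sum (exp (- t)) (λ (k : Fin (suc n)) → w (toℕ k) * (x * t) ^ toℕ k))))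
      (sum-derivative coefficient (λ k → gammaPrimitive-derivative (toℕ k) 0<B))

    antiderivative-zero : antiderivative 0ℝ ≈ - laplace
    antiderivative-zero = begin-equality
      antiderivative 0ℝ
        ≈⟨ sum-cong-≋ {suc n} (λ k → ≈-trans
             (*-cong ≈-refl (gammaPrimitive-zero (toℕ k)))
             (solve 3 (λ w p m → (w :* p) :* (:- m) := (:- con 1ℚ) :* (m :* w :* p)) ≈-refl
               (w (toℕ k)) (x ^ toℕ k) (fromNat (toℕ k !)))) ⟩
      sum {suc n} (λ k → - 1ℝ * (fromNat (toℕ k !) * w (toℕ k) * x ^ toℕ k))
        ≈⟨ ≈-sym (*-distribˡ-sum (- 1ℝ) (λ (k : Fin (suc n)) → fromNat (toℕ k !) * w (toℕ k) * x ^ toℕ k)) ⟩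
      - 1ℝ * laplace
        ≈⟨ solve 1 (λ l → (:- con 1ℚ) :* l := :- l) ≈-refl laplace ⟩
      - laplace ∎

    -- The value at 0 is minus `laplace`, so both constants cancel and `antiderivative` itself
    -- remains, a finite combination of vanishing primitives.
    antiderivative-difference : Vanishes (λ b → (antiderivative b - antiderivative 0ℝ) - laplace)
    antiderivative-difference = vanishes-cong
      (λ b → ≈-sym (≈-trans (+-cong (+-cong ≈-refl (-‿cong antiderivative-zero)) ≈-refl)
        (solve 2 (λ g l → (g :- (:- l)) :- l := g) ≈-refl (antiderivative b) laplace)))
      (vanishes-sum coefficient (λ k → gammaPrimitive-vanishes (toℕ k)))

  -- Specialisation to the Whitney coefficients

  integrand≡ : ∀ w n x t → integrand w n x t
    ≡ RawSemiringDefs.sum (RawRing.rawSemiring Defs.ℝ-rawRing) {suc n} (λ k → w (toℕ k)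
        Defs.* RawSemiringDefs._^_ (RawRing.rawSemiring Defs.ℝ-rawRing) (x Defs.* t) (toℕ k))
      Defs.* Defs.exp (Defs.- t)
  integrand≡ w n x t = unfold-operations
    (λ _ _ _ _*′_ -′_ _ exp′ sum′ _^′_ → integrand w n x t
      ≡ sum′ {suc n} (λ k → w (toℕ k) *′ ((x *′ t) ^′ toℕ k)) *′ exp′ (-′ t))
    ≡.refl

  laplace≡ : ∀ w n x → laplace w n x
    ≡ RawSemiringDefs.sum (RawRing.rawSemiring Defs.ℝ-rawRing) {suc n}
        (λ k → (Defs.fromNat (toℕ k !) Defs.* w (toℕ k))
          Defs.* RawSemiringDefs._^_ (RawRing.rawSemiring Defs.ℝ-rawRing) x (toℕ k))
  laplace≡ w n x = unfold-operations
    (λ _ fromNat′ _ _*′_ _ _ _ sum′ _^′_ → laplace w n x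
      ≡ sum′ {suc n} (λ k → (fromNat′ (toℕ k !) *′ w (toℕ k)) *′ (x ^′ toℕ k)))
    ≡.refl

  module _ (a : ℝ) (m : ℕ) .{{m≢0 : NonZero m}} (n : ℕ) (x : ℝ) where

    D̃≡ : ∀ y → Defs.D̃ m {{m≢0}} a n y ≡ RawSemiringDefs.sum (RawRing.rawSemiring Defs.ℝ-rawRing) {suc n}
      (λ k → Defs.W̃ m {{m≢0}} a n (toℕ k)
        Defs.* RawSemiringDefs._^_ (RawRing.rawSemiring Defs.ℝ-rawRing) y (toℕ k))
    D̃≡ y = ≡.refl

    F̃≡ : Defs.F̃ m {{m≢0}} a n x ≡ RawSemiringDefs.sum (RawRing.rawSemiring Defs.ℝ-rawRing) {suc n}
      (λ k → (Defs.fromNat (toℕ k !) Defs.* Defs.W̃ m {{m≢0}} a n (toℕ k))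
        Defs.* RawSemiringDefs._^_ (RawRing.rawSemiring Defs.ℝ-rawRing) x (toℕ k))
    F̃≡ = ≡.refl

    -- Not by cong: its implicit arguments would be sought by unifying reals componentwise.
    integrand≡D̃ : ∀ t → integrand (Defs.W̃ m {{m≢0}} a n) n x t
      ≡ Defs.D̃ m {{m≢0}} a n (x Defs.* t) Defs.* Defs.exp (Defs.- t)
    integrand≡D̃ t = replace (Defs.D̃ m {{m≢0}} a n (x Defs.* t)) (Defs.exp (Defs.- t))
      (D̃≡ (x Defs.* t)) (integrand≡ (Defs.W̃ m {{m≢0}} a n) n x t)
      where
      replace : ∀ {u v} y z → y ≡ v → u ≡ v Defs.* z → u ≡ y Defs.* z
      replace y z ≡.refl u≡ = u≡

    laplace≡F̃ : laplace (Defs.W̃ m {{m≢0}} a n) n x ≡ Defs.F̃ m {{m≢0}} a n x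
    laplace≡F̃ = ≡.trans (laplace≡ (Defs.W̃ m {{m≢0}} a n) n x) (≡.sym F̃≡)

    dowling-integral : Defs.IsIntegral₀^∞
      (λ t → Defs.D̃ m {{m≢0}} a n (x Defs.* t) Defs.* Defs.exp (Defs.- t)) (Defs.F̃ m {{m≢0}} a n x)
    dowling-integral = isIntegral₀^∞
      (λ 0<B → derivative-cong (λ _ → ≈-refl) (λ t → ≈-reflexive (integrand≡D̃ t))
        (antiderivative-derivative (Defs.W̃ m {{m≢0}} a n) n x 0<B))
      (vanishes-cong
        (λ b → +-cong ≈-refl (-‿cong (≈-reflexive laplace≡F̃)))
        (antiderivative-difference (Defs.W̃ m {{m≢0}} a n) n x))

open import Defs

theorem5 : (a : ℝ) (m : ℕ) .{{_ : NonZero m}} (n : ℕ) (x : ℝ) →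
    IsIntegral₀^∞ (λ t → D̃ m a n (x * t) * exp (- t)) (F̃ m a n x)
theorem5 a m {{m≢0}} n x = Calculus.dowling-integral a m {{m≢0}} n x
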